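{- The following $m$-equivalences hold: $\{121,1233\}\sim\{121,2133\}$ and $\{112,1233\}\sim\{112,2133\}$.
   Context: A (finite, reduced) multiset is $S=1^{a_1}2^{a_2}\cdots k^{a_k}$ with $k\ge 1$ and all $a_i\ge 1$, meaning that $i$ occurs with multiplicity $a_i$. A multipermutation of $S$ is a word having exactly $a_i$ occurrences of each letter $i\in[k]=\{1,\dots,k\}$ and no other letters. A word $\pi=\pi_1\cdots\pi_n$ contains a pattern (word) $\rho=\rho_1\cdots\rho_\ell$ if there are indices $i(1)<\cdots<i(\ell)$ such that for all $a,b\in[\ell]$: $\pi_{i(a)}<\pi_{i(b)}$ iff $\rho_a<\rho_b$, and $\pi_{i(a)}>\pi_{i(b)}$ iff $\rho_a>\rho_b$; otherwise $\pi$ avoids $\rho$. For a set $P$ of patterns, $\mathrm{av}(S;P)$ is the number of multipermutations of $S$ that avoid every pattern in $P$. Two sets of patterns $P,Q$ are $m$-equivalent, written here $P\sim Q$, if $\mathrm{av}(S;P)=\mathrm{av}(S;Q)$ for every multiset $S$. -}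

module Defs where

open import Data.Fin.Base as Fin using (Fin; toℕ; fromℕ<; funToFin; finToFun; punchIn)
open import Data.Fin.Properties as Fin using (all?; any?; finToFun-funToFin; toℕ-fromℕ<; toℕ-injective; punchInᵢ≢i)
open import Data.List.Base using (List; []; _∷_; length; lookup; filter; map; upTo; cartesianProductWith)
open import Data.List.Membership.Propositional using (_∈_)
open import Data.List.Membership.Propositional.Properties using (∈-filter⁺; ∈-filter⁻; ∈-map⁺; ∈-upTo⁺; ∈-cartesianProductWith⁺)
open import Data.List.Properties using (filter-accept; filter-reject; ∷-injective)
open import Data.List.Relation.Unary.All as All using (All; []; _∷_)
open import Data.List.Relation.Unary.AllPairs using ([]; _∷_)
open import Data.List.Relation.Unary.Any using (here)
open import Data.List.Relation.Unary.Unique.Propositional using (Unique)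
import Data.List.Relation.Unary.Unique.Propositional.Properties as Unique
open import Data.Nat.Base using (ℕ; zero; suc; _+_; _≤_; _<_; _>_)
open import Data.Nat.Properties using (_≟_; _<?_; _≤?_; suc-injective; +-0-commutativeMonoid)
open import Algebra.Properties.CommutativeMonoid.Sum +-0-commutativeMonoid using (sum; sum-remove; sum-cong-≋; sum-replicate-zero; ∑-distrib-+)
open import Data.Product.Base using (_×_; _,_; proj₁; proj₂; ∃)
open import Function.Bundles using (_⇔_; mk⇔; Equivalence)
open import Relation.Binary.PropositionalEquality using (_≡_; _≗_; refl; sym; trans; cong; cong₂; subst; subst₂; module ≡-Reasoning)
open import Relation.Nullary using (¬_; Dec; yes; no)
open import Relation.Nullary.Decidable as Dec using (_×-dec_; _→-dec_; ¬?)

Word : Set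
Word = List ℕ

-- The multiset 1^{a₁} ⋯ k^{aₖ}.  As Fin k starts at 0, `mult i` is the
-- multiplicity of the letter `suc (toℕ i)`.
record Multiset : Set where
  field
    k      : ℕ
    k≥1    : 1 ≤ k
    mult   : Fin k → ℕ
    mult≥1 : ∀ i → 1 ≤ mult i

  size : ℕ
  size = sum mult

open Multiset

occurrences : ℕ → Word → ℕ
occurrences x w = length (filter (x ≟_) w)

IsMultiperm : Multiset → Word → Set
IsMultiperm S w =
  (∀ (i : Fin (k S)) → occurrences (suc (toℕ i)) w ≡ mult S i) ×
  All (λ x → 1 ≤ x × x ≤ k S) w

-- ι lists the (0-based) positions i(1) < ⋯ < i(ℓ) in π of a copy of ρ.
IsCopy : (π ρ : Word) → (Fin (length ρ) → Fin (length π)) → Set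
IsCopy π ρ ι =
  (∀ a b → a Fin.< b → ι a Fin.< ι b) ×
  (∀ a b → (lookup π (ι a) < lookup π (ι b) ⇔ lookup ρ a < lookup ρ b) ×
           (lookup π (ι a) > lookup π (ι b) ⇔ lookup ρ a > lookup ρ b))

_Contains_ : Word → Word → Set
π Contains ρ = ∃ λ (ι : Fin (length ρ) → Fin (length π)) → IsCopy π ρ ι

_Avoids_ : Word → Word → Set
π Avoids ρ = ¬ (π Contains ρ)

-- Finite sets of patterns are given by lists; order and repetition are
-- irrelevant to `AvoidsAll`.
AvoidsAll : List Word → Word → Set
AvoidsAll P π = All (π Avoids_) P

private
  _⇔-dec_ : ∀ {A B : Set} → Dec A → Dec B → Dec (A ⇔ B)
  A? ⇔-dec B? = Dec.map′ (λ (f , g) → mk⇔ f g)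
                         (λ e → Equivalence.to e , Equivalence.from e)
                         ((A? →-dec B?) ×-dec (B? →-dec A?))

  isCopy? : ∀ π ρ ι → Dec (IsCopy π ρ ι)
  isCopy? π ρ ι =
    all? (λ a → all? λ b → (a Fin.<? b) →-dec (ι a Fin.<? ι b)) ×-dec
    all? (λ a → all? λ b →
      ((lookup π (ι a) <? lookup π (ι b)) ⇔-dec (lookup ρ a <? lookup ρ b)) ×-dec
      ((lookup π (ι b) <? lookup π (ι a)) ⇔-dec (lookup ρ b <? lookup ρ a)))

  isCopy-resp-≗ : ∀ π ρ {ι κ} → ι ≗ κ → IsCopy π ρ ι → IsCopy π ρ κ
  isCopy-resp-≗ π ρ ι≗κ (inc , iso) =
    (λ a b a<b → subst₂ Fin._<_ (ι≗κ a) (ι≗κ b) (inc a b a<b)) ,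
    (λ a b → subst₂ (λ i j →
      (lookup π i < lookup π j ⇔ lookup ρ a < lookup ρ b) ×
      (lookup π i > lookup π j ⇔ lookup ρ a > lookup ρ b))
      (ι≗κ a) (ι≗κ b) (iso a b))

_contains?_ : ∀ π ρ → Dec (π Contains ρ)
π contains? ρ =
  Dec.map′ (λ (c , p) → finToFun c , p)
           (λ (ι , p) → funToFin ι ,
              isCopy-resp-≗ π ρ (λ a → sym (finToFun-funToFin ι a)) p)
           (any? (λ c → isCopy? π ρ (finToFun {length π} {length ρ} c)))

avoidsAll? : ∀ P π → Dec (AvoidsAll P π)
avoidsAll? P π = All.all? (λ ρ → ¬? (π contains? ρ)) P

isMultiperm? : ∀ S w → Dec (IsMultiperm S w)
isMultiperm? S w =
  all? (λ i → occurrences (suc (toℕ i)) w ≟ mult S i) ×-dec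
  All.all? (λ x → (1 ≤? x) ×-dec (x ≤? k S)) w

words : List ℕ → ℕ → List Word
words alphabet zero    = [] ∷ []
words alphabet (suc n) = cartesianProductWith _∷_ alphabet (words alphabet n)

-- All multipermutations of S, each exactly once: see `∈-multiperms` and
-- `multiperms-unique`.
multiperms : Multiset → List Word
multiperms S = filter (isMultiperm? S) (words (map suc (upTo (k S))) (size S))

av : Multiset → List Word → ℕ
av S P = length (filter (avoidsAll? P) (multiperms S))

infix 4 _∼_

_∼_ : List Word → List Word → Set
P ∼ Q = ∀ (S : Multiset) → av S P ≡ av S Q

private
  length≡sum-occurrences : ∀ n w → All (λ x → 1 ≤ x × x ≤ n) w →
                        length w ≡ sum (λ (i : Fin n) → occurrences (suc (toℕ i)) w)
  length≡sum-occurrences n [] [] = sym (sum-replicate-zero n)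
  length≡sum-occurrences n@(suc m) (suc x ∷ w) ((_ , x<n) ∷ ps) = begin
    1 + length w       ≡⟨ cong₂ _+_ (sym sumδ≡1) (length≡sum-occurrences n w ps) ⟩
    sum δ + sum occ        ≡⟨ ∑-distrib-+ δ occ ⟨
    sum (λ i → δ i + occ i) ≡⟨ sum-cong-≋ (λ i → sym (step i)) ⟩
    sum (λ (i : Fin n) → occurrences (suc (toℕ i)) (suc x ∷ w)) ∎
    where
    open ≡-Reasoning
    occ δ : Fin n → ℕ
    occ i = occurrences (suc (toℕ i)) w
    δ i = occurrences (suc (toℕ i)) (suc x ∷ [])
    j : Fin n
    j = fromℕ< x<n
    step : ∀ i → occurrences (suc (toℕ i)) (suc x ∷ w) ≡ δ i + occ i
    step i with suc (toℕ i) ≟ suc x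
    ... | yes p = trans (cong length (filter-accept (suc (toℕ i) ≟_) p))
                        (cong (λ z → length z + occ i) (sym (filter-accept (suc (toℕ i) ≟_) {xs = []} p)))
    ... | no ¬p = trans (cong length (filter-reject (suc (toℕ i) ≟_) ¬p))
                        (cong (λ z → length z + occ i) (sym (filter-reject (suc (toℕ i) ≟_) {xs = []} ¬p)))
    δj≡1 : δ j ≡ 1
    δj≡1 = cong length (filter-accept (suc (toℕ j) ≟_) {xs = []} (cong suc (toℕ-fromℕ< x<n)))
    δ≡0 : ∀ i → δ (punchIn j i) ≡ 0
    δ≡0 i = cong length (filter-reject (suc (toℕ (punchIn j i)) ≟_) {xs = []}
      λ e → punchInᵢ≢i j i (toℕ-injective (trans (suc-injective e) (sym (toℕ-fromℕ< x<n)))))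
    sumδ≡1 : sum δ ≡ 1
    sumδ≡1 = trans (sum-remove {i = j} δ)
      (cong₂ _+_ δj≡1 (trans (sum-cong-≋ δ≡0)
                             (sum-replicate-zero m)))

  ∈-words : ∀ {alphabet} w → All (_∈ alphabet) w → w ∈ words alphabet (length w)
  ∈-words []      []       = here refl
  ∈-words (x ∷ w) (p ∷ ps) = ∈-cartesianProductWith⁺ _∷_ p (∈-words w ps)

  words-unique : ∀ {alphabet} → Unique alphabet → ∀ n → Unique (words alphabet n)
  words-unique u zero    = [] ∷ []
  words-unique u (suc n) = Unique.cartesianProductWith⁺ _∷_ ∷-injective u (words-unique u n)

  ∈-letters : ∀ {n x} → 1 ≤ x × x ≤ n → x ∈ map suc (upTo n)
  ∈-letters {x = suc _} (_ , x<n) = ∈-map⁺ suc (∈-upTo⁺ x<n)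

∈-multiperms : ∀ S w → w ∈ multiperms S ⇔ IsMultiperm S w
∈-multiperms S w = mk⇔
  (λ w∈ → proj₂ (∈-filter⁻ (isMultiperm? S) {xs = words _ (size S)} w∈))
  (λ p → ∈-filter⁺ (isMultiperm? S)
    (subst (λ n → w ∈ words _ n)
      (trans (length≡sum-occurrences (k S) w (proj₂ p))
             (sum-cong-≋ (proj₁ p)))
      (∈-words w (All.map ∈-letters (proj₂ p))))
    p)

multiperms-unique : ∀ S → Unique (multiperms S)
multiperms-unique S = Unique.filter⁺ (isMultiperm? S)
  (words-unique (Unique.map⁺ suc-injective (Unique.upTo⁺ (k S))) (size S))

{-# OPTIONS --safe #-}
-- Let w avoid 121 (resp. 112) and let x be smaller than all its letters.  The words that avoid 121
-- (resp. 112), contain x exactly 1 + a times and become w when x is erased are the words u x^(1+p) v x^q with w = u v,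
-- where (p , q) = (a , 0) (resp. (0 , a)).  If w avoids 1233, such a word avoids it iff v avoids 122;
-- if w avoids 2133, such a word avoids it iff no letter of u is below a letter repeated in v.
-- Call the admissible splittings u v the sites of w; those where v has distinct letters are always
-- sites.  Let s be the number of sites and e the number of splittings with v distinct.
-- Inserting at a site with v distinct gives a word with s + 1 + p + q sites.  The words from the
-- other sites have q + 1 + j sites, where j takes each of the values e , … , s − 1 once: for 1233,
-- j is the length of v; for 2133, j − e is the number of sites with a shorter u.  The new value of
-- e depends only on e, p, q and, if v is distinct, the length of v.  So both classes of words grow
-- from the empty word by the same succession rule on the states (s , e).
module Submission where

open import Data.Fin.Base as Fin using (Fin; zero; suc; toℕ)
open import Data.Fin.Patterns using (0F; 1F; 2F; 3F)
open import Data.List.Base using (List; []; _∷_; _++_; map; concatMap; filter; length; lookup; replicate; tabulate; drop)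
open import Data.List.Properties hiding (sum-++)
open import Data.List.Membership.Propositional using (_∈_; _∉_; find; lose)
open import Data.List.Membership.Propositional.Properties using (∈-filter⁺; ∈-filter⁻; ∈-++⁺ʳ; ∈-map⁺; ∈-map⁻; ∈-concatMap⁺; ∈-concatMap⁻; ∈-lookup)
open import Data.List.Membership.Propositional.Properties.WithK using (unique∧set⇒bag)
open import Data.List.Relation.Binary.BagAndSetEquality using (∼bag⇒↭)
open import Data.List.Relation.Binary.Permutation.Propositional.Properties using (↭-length)
open import Data.List.Relation.Binary.Sublist.DecPropositional using (_⊆?_)
open import Data.List.Relation.Binary.Sublist.Propositional using (_⊆_; []; _∷_; _∷ʳ_; ⊆-refl; ⊆-trans; ⊆-reflexive; minimum; to∈; from∈)
open import Data.List.Relation.Binary.Sublist.Propositional.Properties using (++⁺ˡ; ++⁺ʳ; ++⁺; ∷ˡ⁻; ∷⁻; filter⁺; filter-⊆; drop⁺-≥)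
open import Data.List.Relation.Unary.All as All using (All; []; _∷_)
import Data.List.Relation.Unary.All.Properties as All
open import Data.List.Relation.Unary.AllPairs as AllPairs using (AllPairs; []; _∷_)
import Data.List.Relation.Unary.AllPairs.Properties as AllPairs
open import Data.List.Relation.Unary.Any using (here; there)
open import Data.List.Relation.Unary.Unique.Propositional using (Unique)
import Data.List.Relation.Unary.Unique.Propositional.Properties as Unique
open import Data.Nat.Base
open import Data.Nat.ListAction using (sum)
open import Data.Nat.ListAction.Properties using (sum-++)
open import Data.Nat.Properties
open import Data.Nat.Tactic.RingSolver using (solve-∀)
open import Data.Product.Base using (_×_; _,_; proj₁; proj₂; ∃; ∃₂)
open import Data.Sum.Base using (_⊎_; inj₁; inj₂)
open import Function.Base using (_∘_; id)
open import Function.Bundles using (_⇔_; mk⇔; Equivalence)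
open import Relation.Binary.Definitions using (tri<; tri≈; tri>)
open import Relation.Binary.PropositionalEquality
open import Relation.Nullary using (¬_; Dec; yes; no; contradiction)
open import Relation.Nullary.Decidable as Dec using (_×-dec_; _→-dec_; ¬?; from-yes)
open import Defs

open Equivalence using (to; from)

-- Patterns as sublists

pick : ℕ → ℕ → ℕ → ℕ → ℕ
-- Pattern letters start at 1; the value at 0 is a default.
pick a b c 0 = a
pick a b c 1 = a
pick a b c 2 = b
pick a b c _ = c

infix 4 _Omits_

-- For patterns ρ over the letters 1, 2, 3, this is avoidance of ρ.
_Omits_ : Word → Word → Set
w Omits ρ = ∀ a b c → a < b → b < c → ¬ (map (pick a b c) ρ ⊆ w)

Omits-⊆ : ∀ {ρ v w} → v ⊆ w → w Omits ρ → v Omits ρ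
Omits-⊆ v⊆w o a b c a<b b<c s = o a b c a<b b<c (⊆-trans s v⊆w)

Increasing : ∀ {m n} → (Fin m → Fin n) → Set
Increasing ι = ∀ a b → a Fin.< b → ι a Fin.< ι b

lookup∷drop : ∀ (w : Word) i → lookup w i ∷ drop (suc (toℕ i)) w ≡ drop (toℕ i) w
lookup∷drop (x ∷ w) zero    = refl
lookup∷drop (x ∷ w) (suc i) = lookup∷drop w i

-- By induction on the number of positions: after the first one, the rest lies in the suffix behind
-- it. Hence the general `drop k w` in place of `w`.
tabulate-⊆-drop : ∀ {n k} (w : Word) (ι : Fin n → Fin (length w)) → Increasing ι →
                  (∀ a → k ≤ toℕ (ι a)) → tabulate (lookup w ∘ ι) ⊆ drop k w
tabulate-⊆-drop {zero}  w ι inc k≤ι = minimum _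
tabulate-⊆-drop {suc n} w ι inc k≤ι = ⊆-trans
  (⊆-trans (refl ∷ tabulate-⊆-drop w (ι ∘ suc) (λ a b a<b → inc (suc a) (suc b) (s≤s a<b))
                                   (λ a → inc zero (suc a) z<s))
           (⊆-reflexive (lookup∷drop w (ι zero))))
  (drop⁺-≥ (k≤ι zero))

⊆⇒embedding : ∀ {g : ℕ → ℕ} {ρ w} → map g ρ ⊆ w →
  ∃ λ (ι : Fin (length ρ) → Fin (length w)) → Increasing ι × (∀ i → lookup w (ι i) ≡ g (lookup ρ i))
⊆⇒embedding {ρ = []} s = (λ ()) , (λ ()) , (λ ())
⊆⇒embedding {ρ = r ∷ ρ} (y ∷ʳ s) with ⊆⇒embedding {ρ = r ∷ ρ} s
... | ι , inc , eq = suc ∘ ι , (λ a b a<b → s≤s (inc a b a<b)) , eq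
⊆⇒embedding {g} {r ∷ ρ} {w = y ∷ w} (refl ∷ s) with ⊆⇒embedding {g} {ρ} s
... | ι , inc , eq = κ , κ-inc , κ-eq
  where
  κ : Fin (suc (length ρ)) → Fin (suc (length w))
  κ zero    = zero
  κ (suc i) = suc (ι i)
  κ-inc : Increasing κ
  κ-inc zero    (suc b) _   = z<s
  κ-inc (suc a) (suc b) a<b = s≤s (inc a b (s≤s⁻¹ a<b))
  κ-eq : ∀ i → lookup (y ∷ w) (κ i) ≡ g (lookup (r ∷ ρ) i)
  κ-eq zero    = refl
  κ-eq (suc i) = eq i

pick-mono : ∀ {a b c m n} → a < b → b < c → 1 ≤ m → n ≤ 3 → m < n → pick a b c m < pick a b c n
pick-mono {m = 1} {n = 2} a<b b<c _ _ _ = a<b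
pick-mono {m = 1} {n = 3} a<b b<c _ _ _ = <-trans a<b b<c
pick-mono {m = 2} {n = 3} a<b b<c _ _ _ = b<c
pick-mono {n = 0} _ _ _ _ ()
pick-mono {m = suc _} {n = 1} _ _ _ _ (s≤s ())
pick-mono {m = suc (suc _)} {n = 2} _ _ _ _ (s≤s (s≤s ()))
pick-mono {m = suc (suc (suc _))} {n = 3} _ _ _ _ (s≤s (s≤s (s≤s ())))
pick-mono {n = suc (suc (suc (suc _)))} _ _ _ (s≤s (s≤s (s≤s ())))

-- `pick a b c` is strictly increasing on 1, 2, 3 and, by trichotomy, reflects the order there, so
-- the positions of the sublist form a copy.
avoids⇒omits : ∀ {π} ρ → All (λ n → 1 ≤ n × n ≤ 3) ρ → π Avoids ρ → π Omits ρ
avoids⇒omits {π} ρ letters av a b c a<b b<c s with ⊆⇒embedding {ρ = ρ} s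
... | ι , inc , eq = av (ι , inc , λ i j → iso i j , iso j i)
  where
  g = pick a b c
  bounds : ∀ i → 1 ≤ lookup ρ i × lookup ρ i ≤ 3
  bounds i = All.lookup letters (∈-lookup i)
  mono : ∀ i j → lookup ρ i < lookup ρ j → g (lookup ρ i) < g (lookup ρ j)
  mono i j = pick-mono a<b b<c (proj₁ (bounds i)) (proj₂ (bounds j))
  reflect : ∀ i j → g (lookup ρ i) < g (lookup ρ j) → lookup ρ i < lookup ρ j
  reflect i j lt with <-cmp (lookup ρ i) (lookup ρ j)
  ... | tri< l _ _ = l
  ... | tri≈ _ e _ = contradiction (cong g e) (<⇒≢ lt)
  ... | tri> _ _ l = contradiction (mono j i l) (<-asym lt)
  iso : ∀ i j → lookup π (ι i) < lookup π (ι j) ⇔ lookup ρ i < lookup ρ j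
  iso i j = mk⇔ (λ lt → reflect i j (subst₂ _<_ (eq i) (eq j) lt))
                (λ lt → subst₂ _<_ (sym (eq i)) (sym (eq j)) (mono i j lt))

copy-< : ∀ π {ρ ι} → IsCopy π ρ ι → ∀ i j → lookup ρ i < lookup ρ j → lookup π (ι i) < lookup π (ι j)
copy-< π (_ , iso) i j = from (proj₁ (iso i j))

-- `IsCopy` speaks of strict comparisons only; equality is what trichotomy leaves.
copy-≡ : ∀ π {ρ ι} → IsCopy π ρ ι → ∀ i j → lookup ρ i ≡ lookup ρ j → lookup π (ι i) ≡ lookup π (ι j)
copy-≡ π {ρ} {ι} (_ , iso) i j e with <-cmp (lookup π (ι i)) (lookup π (ι j))
... | tri< l _ _ = contradiction e (<⇒≢ (to (proj₁ (iso i j)) l))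
... | tri≈ _ p _ = p
... | tri> _ _ l = contradiction (sym e) (<⇒≢ (to (proj₂ (iso i j)) l))

copy⇒⊆ : ∀ {π ρ ι} g → IsCopy π ρ ι → (∀ i → lookup π (ι i) ≡ g (lookup ρ i)) → map g ρ ⊆ π
copy⇒⊆ {π} {ρ} {ι} g (inc , _) eq = ⊆-trans (⊆-reflexive map≡tabulate) (tabulate-⊆-drop π ι inc (λ _ → z≤n))
  where
  map≡tabulate : map g ρ ≡ tabulate (lookup π ∘ ι)
  map≡tabulate = trans (trans (cong (map g) (sym (tabulate-lookup ρ))) (map-tabulate (lookup ρ) g))
                       (tabulate-cong (sym ∘ eq))

letters? : ∀ ρ → Dec (All (λ n → 1 ≤ n × n ≤ 3) ρ)
letters? = All.all? (λ n → (1 ≤? n) ×-dec (n ≤? 3))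

p121 p112 p1233 p2133 : Word
p121  = 1 ∷ 2 ∷ 1 ∷ []
p112  = 1 ∷ 1 ∷ 2 ∷ []
p1233 = 1 ∷ 2 ∷ 3 ∷ 3 ∷ []
p2133 = 2 ∷ 1 ∷ 3 ∷ 3 ∷ []

omits⇒avoids-121 : ∀ {π} → π Omits p121 → π Avoids p121
-- The pattern has no letter 3, so any number above `b` may stand for it.
omits⇒avoids-121 {π} o (ι , c) = o a b (suc b) (copy-< π c 0F 1F (from-yes (1 <? 2))) (n<1+n b)
  (copy⇒⊆ (pick a b (suc b)) c λ { 0F → refl ; 1F → refl ; 2F → copy-≡ π c 2F 0F refl })
  where
  a = lookup π (ι 0F)
  b = lookup π (ι 1F)

omits⇒avoids-112 : ∀ {π} → π Omits p112 → π Avoids p112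
omits⇒avoids-112 {π} o (ι , c) = o a b (suc b) (copy-< π c 0F 2F (from-yes (1 <? 2))) (n<1+n b)
  (copy⇒⊆ (pick a b (suc b)) c λ { 0F → refl ; 1F → copy-≡ π c 1F 0F refl ; 2F → refl })
  where
  a = lookup π (ι 0F)
  b = lookup π (ι 2F)

omits⇒avoids-1233 : ∀ {π} → π Omits p1233 → π Avoids p1233
omits⇒avoids-1233 {π} o (ι , c) =
  o (l 0F) (l 1F) (l 2F) (copy-< π c 0F 1F (from-yes (1 <? 2))) (copy-< π c 1F 2F (from-yes (2 <? 3)))
  (copy⇒⊆ (pick (l 0F) (l 1F) (l 2F)) c λ { 0F → refl ; 1F → refl ; 2F → refl ; 3F → copy-≡ π c 3F 2F refl })
  where
  l = lookup π ∘ ι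

omits⇒avoids-2133 : ∀ {π} → π Omits p2133 → π Avoids p2133
omits⇒avoids-2133 {π} o (ι , c) =
  -- The letter 1 stands second in 2133, so its value is `l 1F`.
  o (l 1F) (l 0F) (l 2F) (copy-< π c 1F 0F (from-yes (1 <? 2))) (copy-< π c 0F 2F (from-yes (2 <? 3)))
  (copy⇒⊆ (pick (l 1F) (l 0F) (l 2F)) c λ { 0F → refl ; 1F → refl ; 2F → refl ; 3F → copy-≡ π c 3F 2F refl })
  where
  l = lookup π ∘ ι

-- Sums over the ways of splitting a word

-- Unlike ∑splits, ∑init leaves out the splitting w ++ [].
∑splits ∑init : (Word → Word → ℕ) → Word → ℕ
∑splits f []      = f [] []
∑splits f (c ∷ w) = f [] (c ∷ w) + ∑splits (λ u v → f (c ∷ u) v) w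
∑init f []      = 0
∑init f (c ∷ w) = f [] (c ∷ w) + ∑init (λ u v → f (c ∷ u) v) w

∑splits-cong : ∀ {f g} w → (∀ u v → u ++ v ≡ w → f u v ≡ g u v) → ∑splits f w ≡ ∑splits g w
∑splits-cong []      eq = eq [] [] refl
∑splits-cong (c ∷ w) eq = cong₂ _+_ (eq [] (c ∷ w) refl)
  (∑splits-cong w λ u v uv≡w → eq (c ∷ u) v (cong (c ∷_) uv≡w))

∑init-cong⁺ : ∀ {f g} w → (∀ u c v → u ++ c ∷ v ≡ w → f u (c ∷ v) ≡ g u (c ∷ v)) → ∑init f w ≡ ∑init g w
∑init-cong⁺ []      eq = refl
∑init-cong⁺ (c ∷ w) eq = cong₂ _+_ (eq [] c w refl)
  (∑init-cong⁺ w λ u d v uv≡w → eq (c ∷ u) d v (cong (c ∷_) uv≡w))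

∑init-cong : ∀ {f g} w → (∀ u v → u ++ v ≡ w → f u v ≡ g u v) → ∑init f w ≡ ∑init g w
∑init-cong w eq = ∑init-cong⁺ w (λ u c v → eq u (c ∷ v))

-- The cut at the border of `a` and `b` is counted in the second sum, which is why the first one is
-- `∑init`.
∑splits-++ : ∀ f a b → ∑splits f (a ++ b) ≡
             ∑init (λ u v → f u (v ++ b)) a + ∑splits (λ u v → f (a ++ u) v) b
∑splits-++ f []      b = refl
∑splits-++ f (c ∷ a) b = trans (cong (f [] (c ∷ a ++ b) +_) (∑splits-++ (λ u v → f (c ∷ u) v) a b))
                               (sym (+-assoc (f [] (c ∷ a ++ b)) _ _))

∑splits-init : ∀ f w → ∑splits f w ≡ ∑init f w + f w []
∑splits-init f []      = refl
∑splits-init f (c ∷ w) = trans (cong (f [] (c ∷ w) +_) (∑splits-init (λ u v → f (c ∷ u) v) w))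
                               (sym (+-assoc (f [] (c ∷ w)) _ _))

∑init-*ʳ : ∀ f k w → ∑init (λ u v → f u v * k) w ≡ ∑init f w * k
∑init-*ʳ f k []      = refl
∑init-*ʳ f k (c ∷ w) = trans (cong (f [] (c ∷ w) * k +_) (∑init-*ʳ (λ u v → f (c ∷ u) v) k w))
                             (sym (*-distribʳ-+ k (f [] (c ∷ w)) _))

∑init-const : ∀ k w → ∑init (λ _ _ → k) w ≡ length w * k
∑init-const k []      = refl
∑init-const k (c ∷ w) = cong (k +_) (∑init-const k w)

∑splits-const : ∀ k w → ∑splits (λ _ _ → k) w ≡ suc (length w) * k
∑splits-const k []      = sym (+-identityʳ k)
∑splits-const k (c ∷ w) = cong (k +_) (∑splits-const k w)

∑< : ℕ → (ℕ → ℕ) → ℕ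
∑< zero    f = 0
∑< (suc n) f = ∑< n f + f n

∑<-cong : ∀ {f g} n → (∀ i → i < n → f i ≡ g i) → ∑< n f ≡ ∑< n g
∑<-cong zero    eq = refl
∑<-cong (suc n) eq = cong₂ _+_ (∑<-cong n (λ i i<n → eq i (m<n⇒m<1+n i<n))) (eq n (n<1+n n))

∑<-suc : ∀ f n → ∑< (suc n) f ≡ f 0 + ∑< n (f ∘ suc)
∑<-suc f zero    = sym (+-identityʳ (f 0))
∑<-suc f (suc n) = trans (cong (_+ f (suc n)) (∑<-suc f n)) (+-assoc (f 0) _ _)

⟦_⟧ : ∀ {A : Set} → Dec A → ℕ
⟦ yes _ ⟧ = 1
⟦ no  _ ⟧ = 0

⟦⟧-yes : ∀ {A : Set} (a? : Dec A) → A → ⟦ a? ⟧ ≡ 1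
⟦⟧-yes (yes _) a = refl
⟦⟧-yes (no ¬a) a = contradiction a ¬a

⟦⟧-no : ∀ {A : Set} (a? : Dec A) → ¬ A → ⟦ a? ⟧ ≡ 0
⟦⟧-no (yes a) ¬a = contradiction a ¬a
⟦⟧-no (no _)  ¬a = refl

⟦⟧-cong : ∀ {A B : Set} (a? : Dec A) (b? : Dec B) → A ⇔ B → ⟦ a? ⟧ ≡ ⟦ b? ⟧
⟦⟧-cong (yes a) b? A⇔B = sym (⟦⟧-yes b? (to A⇔B a))
⟦⟧-cong (no ¬a) b? A⇔B = sym (⟦⟧-no b? (¬a ∘ from A⇔B))

⟦⟧-× : ∀ {A B C : Set} (a? : Dec A) (b? : Dec B) (c? : Dec C) → A ⇔ (B × C) → ⟦ a? ⟧ ≡ ⟦ b? ⟧ * ⟦ c? ⟧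
⟦⟧-× a? (yes b) (yes c) A⇔B×C = ⟦⟧-yes a? (from A⇔B×C (b , c))
⟦⟧-× a? (yes b) (no ¬c) A⇔B×C = ⟦⟧-no a? (¬c ∘ proj₂ ∘ to A⇔B×C)
⟦⟧-× a? (no ¬b) c?      A⇔B×C = ⟦⟧-no a? (¬b ∘ proj₁ ∘ to A⇔B×C)

-- Erasing a letter

erase keep : ℕ → Word → Word
erase x = filter (λ y → ¬? (x ≟ y))
keep  x = filter (x ≟_)

Fresh Block : ℕ → Word → Set
Fresh x = All (x <_)
Block x = All (x ≡_)

block : ∀ x n → Block x (replicate n x)
block x n = All.replicate⁺ n refl

erase-fresh : ∀ {x w} → Fresh x w → erase x w ≡ w
erase-fresh {x} fw = filter-all (λ y → ¬? (x ≟ y)) (All.map <⇒≢ fw)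

erase-block : ∀ {x t} → Block x t → erase x t ≡ []
erase-block {x} bt = filter-none (λ y → ¬? (x ≟ y)) (All.map (λ e ¬e → ¬e e) bt)

keep-fresh : ∀ {x w} → Fresh x w → keep x w ≡ []
keep-fresh {x} fw = filter-none (x ≟_) (All.map <⇒≢ fw)

keep-block : ∀ {x t} → Block x t → keep x t ≡ t
keep-block {x} bt = filter-all (x ≟_) bt

erase-++ : ∀ x u v → erase x (u ++ v) ≡ erase x u ++ erase x v
erase-++ x = filter-++ (λ y → ¬? (x ≟ y))

keep-++ : ∀ x u v → keep x (u ++ v) ≡ keep x u ++ keep x v
keep-++ x = filter-++ (x ≟_)

erase-head : ∀ x w → erase x (x ∷ w) ≡ erase x w
erase-head x w = filter-reject (λ y → ¬? (x ≟ y)) (λ ¬e → ¬e refl)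

keep-head : ∀ x w → keep x (x ∷ w) ≡ x ∷ keep x w
keep-head x w = filter-accept (x ≟_) refl

erase-⊆ : ∀ x w → erase x w ⊆ w
erase-⊆ x w = filter-⊆ (λ y → ¬? (x ≟ y)) w

-- Filtering both words by the same predicate preserves the sublist relation, and it fixes `s`. This
-- carries occurrences of a pattern without the letter `x` over to the word with `x` erased.
⊆-erase : ∀ {x s w} → All (x ≢_) s → s ⊆ w → s ⊆ erase x w
⊆-erase {x} {s} x∉s s⊆w = ⊆-trans (⊆-reflexive (sym (filter-all P? x∉s)))
                                  (filter⁺ P? P? (λ { refl → id }) s⊆w)
  where P? = λ y → ¬? (x ≟ y)

⊆-keep : ∀ {x s w} → Block x s → s ⊆ w → s ⊆ keep x w
⊆-keep {x} {s} bs s⊆w = ⊆-trans (⊆-reflexive (sym (keep-block bs)))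
                                (filter⁺ (x ≟_) (x ≟_) (λ { refl → id }) s⊆w)

∷-⊆-++ : ∀ {b : ℕ} {s : Word} (u : Word) {t} → b ∷ s ⊆ u ++ t → b ∈ u ⊎ b ∷ s ⊆ t
∷-⊆-++ []      p          = inj₂ p
∷-⊆-++ (y ∷ u) (refl ∷ p) = inj₁ (here refl)
∷-⊆-++ (y ∷ u) (.y ∷ʳ p) with ∷-⊆-++ u p
... | inj₁ b∈u = inj₁ (there b∈u)
... | inj₂ q   = inj₂ q

fresh⇒∉ : ∀ {x} {w : Word} → Fresh x w → x ∉ w
fresh⇒∉ fw x∈w = <-irrefl refl (All.lookup fw x∈w)

-- As x ∉ u, the first letter x of u ++ x ∷ r is the one displayed.
∷-⊆-first : ∀ {x} {s u r : Word} → Fresh x u → x ∷ s ⊆ u ++ x ∷ r → s ⊆ r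
∷-⊆-first {u = u} fu p with ∷-⊆-++ u p
... | inj₁ x∈u = contradiction x∈u (fresh⇒∉ fu)
... | inj₂ q   = ∷⁻ q

-- Words with distinct letters

Distinct : Word → Set
Distinct w = ∀ c → ¬ (c ∷ c ∷ [] ⊆ w)

Distinct-⊆ : ∀ {v w} → v ⊆ w → Distinct w → Distinct v
Distinct-⊆ v⊆w d c s = d c (⊆-trans s v⊆w)

abstract
  Distinct? : ∀ w → Dec (Distinct w)
  Distinct? w = Dec.map′ (λ a c s → All.lookup a (to∈ (∷ˡ⁻ s)) s) (λ d → All.tabulate (λ {c} _ → d c))
                         (All.all? (λ c → ¬? (_⊆?_ _≟_ (c ∷ c ∷ []) w)) w)

-- Two equal letters are either both `x` or both different from `x`, so a repetition lies entirely
-- in one of the two parts.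
Distinct-erase-keep : ∀ x w → Distinct w ⇔ (Distinct (erase x w) × Distinct (keep x w))
Distinct-erase-keep x w = mk⇔
  (λ d → Distinct-⊆ (erase-⊆ x w) d , Distinct-⊆ (filter-⊆ (x ≟_) w) d)
  λ { (de , dk) c s → case c de dk s }
  where
  case : ∀ c → Distinct (erase x w) → Distinct (keep x w) → ¬ (c ∷ c ∷ [] ⊆ w)
  case c de dk s with x ≟ c
  ... | yes e = dk c (⊆-keep (e ∷ e ∷ []) s)
  ... | no ¬e = de c (⊆-erase (¬e ∷ ¬e ∷ []) s)

#distinct : Word → ℕ
#distinct = ∑splits (λ _ v → ⟦ Distinct? v ⟧)

⟦Distinct⟧-erase-keep : ∀ x w {e k} → erase x w ≡ e → keep x w ≡ k →
                        ⟦ Distinct? w ⟧ ≡ ⟦ Distinct? e ⟧ * ⟦ Distinct? k ⟧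
⟦Distinct⟧-erase-keep x w refl refl = ⟦⟧-× (Distinct? w) (Distinct? _) (Distinct? _) (Distinct-erase-keep x w)

Distinct-[] : ⟦ Distinct? [] ⟧ ≡ 1
Distinct-[] = ⟦⟧-yes (Distinct? []) (λ _ ())

-- Inserting all copies of a new least letter

module Insertion (x p q : ℕ) where

  left right : Word
  left  = replicate p x
  right = replicate q x

  ins : Word → Word → Word
  ins u v = u ++ x ∷ left ++ (v ++ right)

  erase-right : ∀ {v} → Fresh x v → erase x (v ++ right) ≡ v
  erase-right {v} fv = trans (erase-++ x v right)
    (trans (cong₂ _++_ (erase-fresh fv) (erase-block (block x q))) (++-identityʳ v))

  erase-block-right : ∀ {t v} → Block x t → Fresh x v → erase x (t ++ (v ++ right)) ≡ v
  erase-block-right {t} {v} bt fv = trans (erase-++ x t (v ++ right))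
    (cong₂ _++_ (erase-block bt) (erase-right fv))

  erase-tail : ∀ {v} → Fresh x v → erase x (left ++ (v ++ right)) ≡ v
  erase-tail fv = erase-block-right (block x p) fv

  erase-ins : ∀ {u v} → Fresh x u → Fresh x v → erase x (ins u v) ≡ u ++ v
  erase-ins {u} {v} fu fv = trans (erase-++ x u _)
    (cong₂ _++_ (erase-fresh fu) (trans (erase-head x (left ++ (v ++ right))) (erase-tail fv)))

  keep-right : ∀ {v} → Fresh x v → keep x (v ++ right) ≡ right
  keep-right {v} fv = trans (keep-++ x v right) (cong₂ _++_ (keep-fresh fv) (keep-block (block x q)))

  keep-block-right : ∀ {t v} → Block x t → Fresh x v → keep x (t ++ (v ++ right)) ≡ t ++ right
  keep-block-right {t} {v} bt fv = trans (keep-++ x t (v ++ right)) (cong₂ _++_ (keep-block bt) (keep-right fv))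

  keep-ins : ∀ {u v} → Fresh x u → Fresh x v → keep x (ins u v) ≡ x ∷ left ++ right
  keep-ins {u} {v} fu fv = trans (keep-++ x u _)
    (cong₂ _++_ (keep-fresh fu) (trans (keep-head x (left ++ (v ++ right)))
                                       (cong (x ∷_) (keep-block-right (block x p) fv))))

  -- The cuts are sorted by place: inside `u`, just before the first `x`, behind it but before the
  -- end of `left`, and from there on.
  ∑splits-ins : ∀ f u v → ∑splits f (ins u v) ≡
    ∑init (λ u₁ u₂ → f u₁ (ins u₂ v)) u +
    (f u (x ∷ left ++ (v ++ right)) +
    (∑init (λ t₁ t₂ → f (u ++ x ∷ t₁) (t₂ ++ (v ++ right))) left +
     ∑splits (λ t₁ t₂ → f (u ++ x ∷ left ++ t₁) t₂) (v ++ right)))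
  ∑splits-ins f u v = trans (∑splits-++ f u (x ∷ left ++ (v ++ right)))
    (cong (∑init (λ u₁ u₂ → f u₁ (ins u₂ v)) u +_)
      (cong₂ _+_ (cong (λ z → f z (x ∷ left ++ (v ++ right))) (++-identityʳ u))
                 (∑splits-++ (λ t₁ t₂ → f (u ++ x ∷ t₁) t₂) left (v ++ right))))

  -- These involve neither `u` nor `v` and so are constants of the succession rule. For instance,
  -- `K₀` is 1 exactly if `x` is inserted once.
  K₀ K₁ K₂ K₃ : ℕ
  K₀ = ⟦ Distinct? (x ∷ left ++ right) ⟧
  K₁ = ∑init (λ _ t → ⟦ Distinct? (t ++ right) ⟧) left
  K₂ = ⟦ Distinct? right ⟧
  K₃ = #distinct right

  -- A suffix is distinct iff its letters above `x` and its copies of `x` both are, so its indicator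
  -- is a product. For the cuts inside `u`, `left` and `v` one of the factors is constant and leaves
  -- the sum.
  #distinct-ins : ∀ {u v} → Fresh x u → Fresh x v →
    #distinct (ins u v) ≡
    ∑init (λ _ t → ⟦ Distinct? (t ++ v) ⟧) u * K₀ +
    (⟦ Distinct? v ⟧ * K₀ + (⟦ Distinct? v ⟧ * K₁ + (∑init (λ _ t → ⟦ Distinct? t ⟧) v * K₂ + K₃)))
  #distinct-ins {u} {v} fu fv = trans (∑splits-ins (λ _ t → ⟦ Distinct? t ⟧) u v)
    (cong₂ _+_
      (trans (∑init-cong u λ u₁ u₂ e →
                let fu₂ = All.++⁻ʳ u₁ (subst (Fresh x) (sym e) fu) in
                ⟦Distinct⟧-erase-keep x (ins u₂ v) (erase-ins fu₂ fv) (keep-ins fu₂ fv))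
             (∑init-*ʳ _ K₀ u))
    (cong₂ _+_
      (⟦Distinct⟧-erase-keep x (ins [] v) (erase-ins [] fv) (keep-ins [] fv))
    (cong₂ _+_
      (trans (∑init-cong left λ t₁ t₂ e →
                let bt₂ = All.++⁻ʳ t₁ (subst (Block x) (sym e) (block x p)) in
                trans (⟦Distinct⟧-erase-keep x (t₂ ++ (v ++ right)) (erase-block-right bt₂ fv) (keep-block-right bt₂ fv))
                      (*-comm ⟦ Distinct? v ⟧ _))
             (trans (∑init-*ʳ _ ⟦ Distinct? v ⟧ left) (*-comm _ ⟦ Distinct? v ⟧)))
    (trans (∑splits-++ (λ _ t → ⟦ Distinct? t ⟧) v right)
      (cong (_+ K₃)
        (trans (∑init-cong v λ v₁ v₂ e →
                  let fv₂ = All.++⁻ʳ v₁ (subst (Fresh x) (sym e) fv) in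
                  ⟦Distinct⟧-erase-keep x (v₂ ++ right) (erase-right fv₂) (keep-right fv₂))
               (∑init-*ʳ _ K₂ v)))))))

  -- The value of `#distinct` after an insertion in front of `j` distinct letters. Of the `e`
  -- distinct suffixes of the old word, `suc j` are suffixes of `v` and the other `e ∸ suc j` are
  -- longer.
  δ : ℕ → ℕ → ℕ
  δ e j = (e ∸ suc j) * K₀ + (K₀ + (K₁ + (j * K₂ + K₃)))

  -- If `v` is not distinct, every distinct suffix of `u ++ v` is a proper suffix of `v`. The 1
  -- taken off is the empty one, whose contribution is in `K₃`.
  δ′ : ℕ → ℕ
  δ′ e = (e ∸ 1) * K₂ + K₃

∑init-distinct : ∀ v → Distinct v → ∑init (λ _ t → ⟦ Distinct? t ⟧) v ≡ length v
∑init-distinct v dv = trans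
  (∑init-cong v λ v₁ v₂ e → ⟦⟧-yes (Distinct? v₂) (Distinct-⊆ (subst (v₂ ⊆_) e (++⁺ˡ v₁ ⊆-refl)) dv))
  (trans (∑init-const 1 v) (*-identityʳ _))

∑init-¬distinct : ∀ u v → ¬ Distinct v → ∑init (λ _ t → ⟦ Distinct? (t ++ v) ⟧) u ≡ 0
∑init-¬distinct u v ¬dv = trans
  (∑init-cong u λ _ t _ → ⟦⟧-no (Distinct? (t ++ v)) (λ d → ¬dv (Distinct-⊆ (++⁺ˡ t ⊆-refl) d)))
  (trans (∑init-const 0 u) (*-zeroʳ (length u)))

-- The `suc` is the empty suffix, which `∑init` leaves out.
#distinct-++ : ∀ u v → #distinct (u ++ v) ≡
  ∑init (λ _ t → ⟦ Distinct? (t ++ v) ⟧) u + suc (∑init (λ _ t → ⟦ Distinct? t ⟧) v)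
#distinct-++ u v = trans (∑splits-++ _ u v)
  (cong (∑init (λ _ t → ⟦ Distinct? (t ++ v) ⟧) u +_)
    (trans (∑splits-init _ v) (trans (cong (β +_) Distinct-[]) (+-comm β 1))))
  where β = ∑init (λ _ t → ⟦ Distinct? t ⟧) v

module _ (x p q : ℕ) {u v} (fu : Fresh x u) (fv : Fresh x v) where
  open Insertion x p q

  #distinct-ins-distinct : Distinct v → #distinct (ins u v) ≡ δ (#distinct (u ++ v)) (length v)
  #distinct-ins-distinct dv
    rewrite #distinct-ins fu fv | #distinct-++ u v | ∑init-distinct v dv | ⟦⟧-yes (Distinct? v) dv
          | m+n∸n≡m (∑init (λ _ t → ⟦ Distinct? (t ++ v) ⟧) u) (suc (length v))
          | +-identityʳ K₀ | +-identityʳ K₁ = refl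

  #distinct-ins-¬distinct : ¬ Distinct v → #distinct (ins u v) ≡ δ′ (#distinct (u ++ v))
  #distinct-ins-¬distinct ¬dv
    rewrite #distinct-ins fu fv | #distinct-++ u v | ∑init-¬distinct u v ¬dv | ⟦⟧-no (Distinct? v) ¬dv = refl

-- Transitions

module Transition (x p q : ℕ) where
  open Insertion x p q

  -- The succession rule, acting on functions of the state: `φ` is summed over the states of the
  -- children of a word in state (s , e). The first sum runs over the lengths `j` of the distinct
  -- suffixes, the second over the other sites. No pattern enters.
  T : (ℕ → ℕ → ℕ) → ℕ → ℕ → ℕ
  T φ s e = ∑< e (λ j → φ (s + suc (p + q)) (δ e j)) + ∑< (s ∸ e) (λ k → φ (q + suc (e + k)) (δ′ e))

-- Summing over the sites of a word

∑splits-mono : ∀ {f g} w → (∀ u v → f u v ≤ g u v) → ∑splits f w ≤ ∑splits g w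
∑splits-mono []      le = le [] []
∑splits-mono (c ∷ w) le = +-mono-≤ (le [] (c ∷ w)) (∑splits-mono w (λ u v → le (c ∷ u) v))

⟦⟧-mono : ∀ {A B : Set} (a? : Dec A) (b? : Dec B) → (A → B) → ⟦ a? ⟧ ≤ ⟦ b? ⟧
⟦⟧-mono (yes a) b? A→B = ≤-reflexive (sym (⟦⟧-yes b? (A→B a)))
⟦⟧-mono (no _)  b? A→B = z≤n

∑splits-all : ∀ {Q : Word → Word → Set} (Q? : ∀ u v → Dec (Q u v)) w →
              (∀ u v → u ++ v ≡ w → Q u v) → ∑splits (λ u v → ⟦ Q? u v ⟧) w ≡ suc (length w)
∑splits-all Q? w all = trans (∑splits-cong w λ u v e → ⟦⟧-yes (Q? u v) (all u v e))
                             (trans (∑splits-const 1 w) (*-identityʳ _))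

suffix-⊆ : ∀ (u : Word) {v w} → u ++ v ≡ w → v ⊆ w
suffix-⊆ u refl = ++⁺ˡ u ⊆-refl

#distinct-all : ∀ w → Distinct w → #distinct w ≡ suc (length w)
#distinct-all w dw = ∑splits-all (λ _ v → Distinct? v) w (λ u v e → Distinct-⊆ (suffix-⊆ u e) dw)

choose : ∀ {A : Set} → Dec A → ℕ → ℕ → ℕ
choose (yes _) m n = m
choose (no  _) m n = n

ifDistinct : Word → ℕ → ℕ → ℕ
ifDistinct v = choose (Distinct? v)

-- Sites given by a condition on `v` alone that passes to sublists. The suffixes of `w` with `Q` are
-- those shorter than `#Q w`, the distinct ones those shorter than `#distinct w`; so a site is
-- identified by the length of `v`.
module SuffixSites {Q : Word → Set} (Q? : ∀ v → Dec (Q v))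
                   (Q-⊆ : ∀ {v w} → v ⊆ w → Q w → Q v)
                   (distinct⇒Q : ∀ {v} → Distinct v → Q v) where

  #Q : Word → ℕ
  #Q = ∑splits (λ _ v → ⟦ Q? v ⟧)

  #distinct≤#Q : ∀ w → #distinct w ≤ #Q w
  #distinct≤#Q w = ∑splits-mono w (λ _ v → ⟦⟧-mono (Distinct? v) (Q? v) distinct⇒Q)

  #Q-all : ∀ w → Q w → #Q w ≡ suc (length w)
  #Q-all w qw = ∑splits-all (λ _ v → Q? v) w (λ u v e → Q-⊆ (suffix-⊆ u e) qw)

  ∑sites : ∀ (G H : ℕ → ℕ) w →
    ∑splits (λ _ v → ⟦ Q? v ⟧ * ifDistinct v (G (length v)) (H (length v))) w ≡
    ∑< (#distinct w) G + ∑< (#Q w ∸ #distinct w) (λ k → H (#distinct w + k))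
  ∑sites G H [] with Q? [] | Distinct? []
  ... | yes _ | yes _  = refl
  ... | no ¬q | _      = contradiction (distinct⇒Q (λ _ ())) ¬q
  ... | _     | no ¬d  = contradiction (λ _ ()) ¬d
  ∑sites G H (c ∷ w) with ∑sites G H w | Q? (c ∷ w) | Distinct? (c ∷ w)
  ... | ih | no ¬q | yes d = contradiction (distinct⇒Q d) ¬q
  ... | ih | no ¬q | no ¬d = ih
  -- All suffixes are distinct, so the second sum is empty and the first gains its top term.
  ... | ih | yes _ | yes d
    rewrite ih | #distinct-all w (Distinct-⊆ (c ∷ʳ ⊆-refl) d)
          | #Q-all w (distinct⇒Q (Distinct-⊆ (c ∷ʳ ⊆-refl) d)) | n∸n≡0 (length w) =
      rearrange (G (suc (length w))) (∑< (length w) G) (G (length w))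
    where
    rearrange : ∀ a b c → a + 0 + (b + c + 0) ≡ b + c + a + 0
    rearrange = solve-∀
  -- Every suffix of `w` satisfies `Q`, so the length of `c ∷ w` is `#Q w`, the next index of the
  -- second sum.
  ... | ih | yes q | no ¬d
    rewrite ih | +-∸-assoc 1 (#distinct≤#Q w) =
      trans (rearrange (H (suc (length w))) (∑< e G) (∑< (s ∸ e) (λ k → H (e + k))))
            (cong (λ z → ∑< e G + (∑< (s ∸ e) (λ k → H (e + k)) + H z))
                  (trans (sym (#Q-all w (Q-⊆ (c ∷ʳ ⊆-refl) q))) (sym (m+[n∸m]≡n (#distinct≤#Q w)))))
    where
    e = #distinct w
    s = #Q w
    rearrange : ∀ a b c → a + 0 + (b + c) ≡ b + (c + a)
    rearrange = solve-∀

-- The sites with `v` not distinct are counted from the left. The cuts with `v` distinct are all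
-- sites and stand at the right end, so these indices are consecutive. The offset `k` collects the
-- sites already passed in the induction on `w`.
∑sites-before : ∀ {Q : Word → Word → Set} (Q? : ∀ u v → Dec (Q u v)) →
  (∀ u v → Distinct v → Q u v) → ∀ (G H : ℕ → ℕ) k w →
  ∑splits (λ u v → ⟦ Q? u v ⟧ *
    ifDistinct v (G (length v)) (H (k + ∑init (λ u₁ u₂ → ⟦ Q? u₁ (u₂ ++ v) ⟧) u))) w ≡
  ∑< (#distinct w) G + ∑< (∑splits (λ u v → ⟦ Q? u v ⟧) w ∸ #distinct w) (λ i → H (k + i))
∑sites-before Q? dQ G H k [] with Q? [] [] | Distinct? []
... | yes _ | yes _  = refl
... | no ¬q | _      = contradiction (dQ [] [] (λ _ ())) ¬q
... | _     | no ¬d  = contradiction (λ _ ()) ¬d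
∑sites-before {Q} Q? dQ G H k (c ∷ w) = trans (cong (head +_) tail) rest
  where
  Q′? : ∀ u v → Dec (Q (c ∷ u) v)
  Q′? u v = Q? (c ∷ u) v
  head = ⟦ Q? [] (c ∷ w) ⟧ * ifDistinct (c ∷ w) (G (suc (length w))) (H (k + 0))
  e = #distinct w
  s = ∑splits (λ u v → ⟦ Q′? u v ⟧) w
  -- The cut before `c` has the shortest `u` of all, so its bracket moves into the offset.
  tail : _ ≡ ∑< e G + ∑< (s ∸ e) (λ i → H (k + ⟦ Q? [] (c ∷ w) ⟧ + i))
  tail = trans
    (∑splits-cong w λ { u v refl → cong (λ z → ⟦ Q′? u v ⟧ * ifDistinct v (G (length v)) (H z))
                                       (sym (+-assoc k ⟦ Q? [] (c ∷ u ++ v) ⟧ _)) })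
    (∑sites-before Q′? (λ u → dQ (c ∷ u)) G H (k + ⟦ Q? [] (c ∷ w) ⟧) w)
  e≤s : e ≤ s
  e≤s = ∑splits-mono w (λ u v → ⟦⟧-mono (Distinct? v) (Q′? u v) (dQ (c ∷ u) v))
  rest : head + (∑< e G + ∑< (s ∸ e) (λ i → H (k + ⟦ Q? [] (c ∷ w) ⟧ + i))) ≡
         ∑< (⟦ Distinct? (c ∷ w) ⟧ + e) G + ∑< (⟦ Q? [] (c ∷ w) ⟧ + s ∸ (⟦ Distinct? (c ∷ w) ⟧ + e)) (λ i → H (k + i))
  rest with Q? [] (c ∷ w) | Distinct? (c ∷ w)
  ... | no ¬q | yes d = contradiction (dQ [] _ d) ¬q
  ... | no ¬q | no ¬d = cong (∑< e G +_) (∑<-cong (s ∸ e) (λ i _ → cong (λ z → H (z + i)) (+-identityʳ k)))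
  ... | yes _ | yes d
    rewrite #distinct-all w (Distinct-⊆ (c ∷ʳ ⊆-refl) d)
          | ∑splits-all Q′? w (λ u v uv≡w → dQ (c ∷ u) v (Distinct-⊆ (⊆-trans (suffix-⊆ u uv≡w) (c ∷ʳ ⊆-refl)) d))
          | n∸n≡0 (length w) = rearrange (G (suc (length w))) (∑< (length w) G) (G (length w))
    where
    rearrange : ∀ a b c → a + 0 + (b + c + 0) ≡ b + c + a + 0
    rearrange = solve-∀
  -- The cut before `c` takes the index `k`, and the later sites are shifted by one.
  ... | yes q | no ¬d
    rewrite +-∸-assoc 1 e≤s | ∑<-suc (λ i → H (k + i)) (s ∸ e) =
      trans (rearrange (H (k + 0)) (∑< e G) _)
            (cong (λ z → ∑< e G + (H (k + 0) + z))
                  (∑<-cong (s ∸ e) (λ i _ → cong H (+-assoc k 1 i))))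
    where
    rearrange : ∀ a b c → a + 0 + (b + c) ≡ b + (a + c)
    rearrange = solve-∀

≤-erase : ∀ {x} w → Fresh x (erase x w) → All (x ≤_) w
≤-erase {x} w fe = All.tabulate λ {y} y∈w → bound y y∈w
  where
  bound : ∀ y → y ∈ w → x ≤ y
  bound y y∈w with x ≟ y
  ... | yes e = ≤-reflexive e
  ... | no ¬e = <⇒≤ (All.lookup fe (∈-filter⁺ (λ y → ¬? (x ≟ y)) y∈w ¬e))

-- All that the count needs to know of a pattern: which insertions of a new least letter keep it
-- avoided and, in `∑-children`, that the states of the resulting words follow `Transition.T`.
record Rule (ρ : Word) : Set₁ where
  field
    Site      : Word → Word → Set
    Site?     : ∀ u v → Dec (Site u v)
    Site-[]   : Site [] []
    omits-[]  : [] Omits ρ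
    site⇒omits : ∀ x p q {u v} → Fresh x u → Fresh x v →
                 (u ++ v) Omits ρ → Site u v → Insertion.ins x p q u v Omits ρ
    omits⇒site : ∀ x p q {u v} → Fresh x u → Fresh x v →
                 Insertion.ins x p q u v Omits ρ → Site u v

  #sites : Word → ℕ
  #sites = ∑splits (λ u v → ⟦ Site? u v ⟧)

  field
    ∑-children : ∀ x p q {w} → Fresh x w → ∀ φ →
      ∑splits (λ u v → ⟦ Site? u v ⟧ * φ (#sites (Insertion.ins x p q u v)) (#distinct (Insertion.ins x p q u v))) w ≡
      Transition.T x p q φ (#sites w) (#distinct w)

⟦⟧*-cong : ∀ {A : Set} (a? : Dec A) {m n} → (A → m ≡ n) → ⟦ a? ⟧ * m ≡ ⟦ a? ⟧ * n
⟦⟧*-cong (yes a) eq = cong (1 *_) (eq a)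
⟦⟧*-cong (no _)  eq = refl

ifDistinct-intro : ∀ v {a m n} → (Distinct v → a ≡ m) → (¬ Distinct v → a ≡ n) → a ≡ ifDistinct v m n
ifDistinct-intro v y n with Distinct? v
... | yes d = y d
... | no ¬d = n ¬d

-- The pattern 1233

-- Avoidance of the pattern 122.
NoRise : Word → Set
NoRise v = ∀ b c → b < c → ¬ (b ∷ c ∷ c ∷ [] ⊆ v)

NoRise-⊆ : ∀ {v w} → v ⊆ w → NoRise w → NoRise v
NoRise-⊆ v⊆w nr b c b<c s = nr b c b<c (⊆-trans s v⊆w)

abstract
  NoRise? : ∀ v → Dec (NoRise v)
  NoRise? v = Dec.map′
    (λ a b c b<c s → All.lookup (All.lookup a (to∈ s)) (to∈ (∷ˡ⁻ s)) b<c s)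
    (λ nr → All.tabulate λ {b} _ → All.tabulate λ {c} _ → nr b c)
    (All.all? (λ b → All.all? (λ c → (b <? c) →-dec ¬? (_⊆?_ _≟_ (b ∷ c ∷ c ∷ []) v)) v) v)

distinct⇒noRise : ∀ {v} → Distinct v → NoRise v
distinct⇒noRise d b c _ s = d c (∷ˡ⁻ s)

-- The first x of u ++ x ∷ r serves as the letter 1 of the pattern 122.
noRise-first : ∀ {x u v} r → Fresh x u → Fresh x v → erase x r ≡ v →
               NoRise (u ++ x ∷ r) ⇔ (NoRise (u ++ v) × Distinct v)
noRise-first {x} {u} r fu fv refl = mk⇔
  (λ nr → NoRise-⊆ (++⁺ (⊆-refl {x = u}) (x ∷ʳ erase-⊆ x r)) nr ,
          λ c s → nr x c (All.lookup fv (to∈ s)) (++⁺ˡ u (refl ∷ ⊆-trans s (erase-⊆ x r))))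
  λ { (nr , d) b c b<c s → back nr d b c b<c s }
  where
  erased : erase x (u ++ x ∷ r) ≡ u ++ erase x r
  erased = trans (erase-++ x u (x ∷ r)) (cong₂ _++_ (erase-fresh fu) (erase-head x r))
  back : NoRise (u ++ erase x r) → Distinct (erase x r) → NoRise (u ++ x ∷ r)
  back nr d b c b<c s with x ≟ b
  -- With `b = x`, the pair `c c` lies behind the first `x` and survives erasing; otherwise the
  -- whole occurrence lies above `x` and survives.
  ... | yes refl = d c (⊆-erase (<⇒≢ b<c ∷ <⇒≢ b<c ∷ []) (∷-⊆-first fu s))
  ... | no x≢b   = nr b c b<c (subst (b ∷ c ∷ c ∷ [] ⊆_) erased (⊆-erase (x≢b ∷ x≢c ∷ x≢c ∷ []) s))
    where
    x≤b = All.lookup (≤-erase (u ++ x ∷ r) (subst (Fresh x) (sym erased) (All.++⁺ fu fv))) (to∈ s)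
    x≢c = <⇒≢ (≤-<-trans x≤b b<c)

module Suffixes = SuffixSites NoRise? NoRise-⊆ distinct⇒noRise

#noRise : Word → ℕ
#noRise = Suffixes.#Q

module _ (x p q : ℕ) where
  open Insertion x p q

  -- The appended copies of `x` join no occurrence of 122: nothing larger follows them, and nothing
  -- is smaller than `x`.
  noRise-right : ∀ {v} → Fresh x v → NoRise v → NoRise (v ++ right)
  noRise-right {v} fv nr b c b<c s with x ≟ b
  ... | no x≢b = nr b c b<c (subst (b ∷ c ∷ c ∷ [] ⊆_) (erase-right fv) (⊆-erase (x≢b ∷ x≢c ∷ x≢c ∷ []) s))
    where
    x≤b = All.lookup (≤-erase (v ++ right) (subst (Fresh x) (sym (erase-right fv)) fv)) (to∈ s)
    x≢c = <⇒≢ (≤-<-trans x≤b b<c)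
  ... | yes refl with ∷-⊆-++ v s
  ...   | inj₁ x∈v = fresh⇒∉ fv x∈v
  ...   | inj₂ s′  = <⇒≢ b<c (All.lookup (block x q) (to∈ (∷ˡ⁻ s′)))

  length-tail : ∀ v → length (x ∷ left ++ (v ++ right)) ≡ suc (p + (length v + q))
  length-tail v rewrite length-++ left {v ++ right} | length-++ v {right}
                      | length-replicate p {x} | length-replicate q {x} = refl

  -- A cut inside `u` keeps its status, since all that an `x` in the second part adds is that `v` be
  -- distinct. Every later cut is a site, and there are `suc (p + q)` more of these than in
  -- `u ++ v`.
  #noRise-ins-distinct : ∀ {u v} → Fresh x u → Fresh x v → Distinct v →
                         #noRise (ins u v) ≡ #noRise (u ++ v) + suc (p + q)
  #noRise-ins-distinct {u} {v} fu fv dv = begin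
    #noRise (ins u v)
      ≡⟨ ∑splits-++ (λ _ t → ⟦ NoRise? t ⟧) u _ ⟩
    ∑init (λ _ t → ⟦ NoRise? (ins t v) ⟧) u + #noRise (x ∷ left ++ (v ++ right))
      ≡⟨ cong₂ _+_
           (∑init-cong u λ u₁ u₂ e → ⟦⟧-cong (NoRise? _) (NoRise? _) (drop-dv (first (All.++⁻ʳ u₁ (subst (Fresh x) (sym e) fu)))))
           (Suffixes.#Q-all _ (from (first []) (distinct⇒noRise dv , dv))) ⟩
    a + suc (length (x ∷ left ++ (v ++ right)))
      ≡⟨ cong (λ z → a + suc z) (length-tail v) ⟩
    a + suc (suc (p + (length v + q)))
      ≡⟨ arith a p q (length v) ⟩
    a + suc (length v) + suc (p + q)
      ≡⟨ cong (λ z → a + z + suc (p + q)) (Suffixes.#Q-all v (distinct⇒noRise dv)) ⟨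
    a + #noRise v + suc (p + q)
      ≡⟨ cong (_+ suc (p + q)) (∑splits-++ (λ _ t → ⟦ NoRise? t ⟧) u v) ⟨
    #noRise (u ++ v) + suc (p + q) ∎
    where
    open ≡-Reasoning
    a = ∑init (λ _ t → ⟦ NoRise? (t ++ v) ⟧) u
    first : ∀ {t} → Fresh x t → NoRise (ins t v) ⇔ (NoRise (t ++ v) × Distinct v)
    first ft = noRise-first _ ft fv (erase-tail fv)
    drop-dv : ∀ {A B : Set} → A ⇔ (B × Distinct v) → A ⇔ B
    drop-dv e = mk⇔ (proj₁ ∘ to e) (λ b → from e (b , dv))
    arith : ∀ a p q l → a + suc (suc (p + (l + q))) ≡ a + suc l + suc (p + q)
    arith = solve-∀

  -- A cut with some `x` before `v` in its second part is spoilt by that `x` and a repetition in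
  -- `v`. The cuts from the end of `left` on are all sites.
  #noRise-ins-¬distinct : ∀ {u v} → Fresh x u → Fresh x v → NoRise v → ¬ Distinct v →
                          #noRise (ins u v) ≡ q + suc (length v)
  #noRise-ins-¬distinct {u} {v} fu fv nr ¬dv = begin
    #noRise (ins u v)
      ≡⟨ ∑splits-ins (λ _ t → ⟦ NoRise? t ⟧) u v ⟩
    _ ≡⟨ cong₂ _+_
           (trans (∑init-cong u λ u₁ u₂ e → rises (noRise-first _ (All.++⁻ʳ u₁ (subst (Fresh x) (sym e) fu)) fv (erase-tail fv)))
                  (zeros u))
           (cong₂ _+_ (rises (noRise-first {u = []} _ [] fv (erase-tail fv)))
           (cong₂ _+_
             -- The version with a nonempty second part is needed: it supplies the copy of `x`.
             (trans (∑init-cong⁺ left in-left) (zeros left))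
             (Suffixes.#Q-all _ (noRise-right fv nr)))) ⟩
    suc (length (v ++ right))
      ≡⟨ cong suc (trans (length-++ v) (cong (length v +_) (length-replicate q))) ⟩
    suc (length v + q)
      ≡⟨ +-comm (suc (length v)) q ⟩
    q + suc (length v) ∎
    where
    open ≡-Reasoning
    zeros : ∀ w → ∑init (λ _ _ → 0) w ≡ 0
    zeros w = trans (∑init-const 0 w) (*-zeroʳ (length w))
    rises : ∀ {w} {B : Set} → NoRise w ⇔ (B × Distinct v) → ⟦ NoRise? w ⟧ ≡ 0
    rises {w} e = ⟦⟧-no (NoRise? w) (¬dv ∘ proj₂ ∘ to e)
    in-left : ∀ t c t′ → t ++ c ∷ t′ ≡ left → ⟦ NoRise? ((c ∷ t′) ++ (v ++ right)) ⟧ ≡ 0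
    in-left t c t′ e with All.++⁻ʳ t (subst (Block x) (sym e) (block x p))
    ... | refl ∷ bt′ = rises (noRise-first {u = []} _ [] fv (erase-block-right bt′ fv))

rule-1233 : Rule p1233
rule-1233 = record
  { Site       = λ _ v → NoRise v
  ; Site?      = λ _ v → NoRise? v
  ; Site-[]    = λ _ _ _ ()
  ; omits-[]   = λ _ _ _ _ _ ()
  ; site⇒omits = site⇒omits
  ; omits⇒site = omits⇒site
  ; ∑-children = ∑-children
  }
  where
  site⇒omits : ∀ x p q {u v} → Fresh x u → Fresh x v → (u ++ v) Omits p1233 → NoRise v →
               Insertion.ins x p q u v Omits p1233
  site⇒omits x p q {u} {v} fu fv o nr a b c a<b b<c s with x ≟ a
  -- An `x` can only play the 1, and then the 122 behind it lies in `v`; without `x` the occurrence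
  -- is already one in `u ++ v`.
  ... | yes refl = nr b c b<c (subst (b ∷ c ∷ c ∷ [] ⊆_) (erase-tail fv)
                     (⊆-erase (<⇒≢ a<b ∷ x≢c ∷ x≢c ∷ []) (∷-⊆-first fu s)))
    where
    open Insertion x p q
    x≢c = <⇒≢ (<-trans a<b b<c)
  ... | no x≢a = o a b c a<b b<c (subst (a ∷ b ∷ c ∷ c ∷ [] ⊆_) (erase-ins fu fv)
                   (⊆-erase (x≢a ∷ <⇒≢ x<b ∷ x≢c ∷ x≢c ∷ []) s))
    where
    open Insertion x p q
    x≤a = All.lookup (≤-erase (ins u v) (subst (Fresh x) (sym (erase-ins fu fv)) (All.++⁺ fu fv))) (to∈ s)
    x<b = ≤-<-trans x≤a a<b
    x≢c = <⇒≢ (<-trans x<b b<c)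
  omits⇒site : ∀ x p q {u v} → Fresh x u → Fresh x v → Insertion.ins x p q u v Omits p1233 → NoRise v
  omits⇒site x p q {u} {v} fu fv o b c b<c s =
    -- The inserted `x` in front of `v` plays the 1.
    o x b c (All.lookup fv (to∈ s)) b<c (++⁺ˡ u (refl ∷ ++⁺ˡ left (++⁺ʳ right s)))
    where open Insertion x p q
  ∑-children : ∀ x p q {w} → Fresh x w → ∀ φ →
    ∑splits (λ u v → ⟦ NoRise? v ⟧ * φ (#noRise (Insertion.ins x p q u v)) (#distinct (Insertion.ins x p q u v))) w ≡
    Transition.T x p q φ (#noRise w) (#distinct w)
  ∑-children x p q {w} fw φ = trans
    (∑splits-cong w λ { u v refl → ⟦⟧*-cong (NoRise? v) λ nr → ifDistinct-intro v
      (λ d → cong₂ φ (#noRise-ins-distinct x p q (All.++⁻ˡ u fw) (All.++⁻ʳ u fw) d)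
                     (#distinct-ins-distinct x p q (All.++⁻ˡ u fw) (All.++⁻ʳ u fw) d))
      (λ ¬d → cong₂ φ (#noRise-ins-¬distinct x p q (All.++⁻ˡ u fw) (All.++⁻ʳ u fw) nr ¬d)
                      (#distinct-ins-¬distinct x p q (All.++⁻ˡ u fw) (All.++⁻ʳ u fw) ¬d)) })
    (Suffixes.∑sites (λ j → φ (#noRise w + suc (p + q)) (δ (#distinct w) j))
                     (λ j → φ (q + suc j) (δ′ (#distinct w))) w)
    where open Insertion x p q

-- The pattern 2133

Clear : Word → Word → Set
Clear u v = ∀ b c → b ∈ u → b < c → ¬ (c ∷ c ∷ [] ⊆ v)

abstract
  Clear? : ∀ u v → Dec (Clear u v)
  Clear? u v = Dec.map′
    (λ a b c b∈u b<c s → All.lookup (All.lookup a b∈u) (to∈ s) b<c s)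
    (λ cl → All.tabulate λ {b} b∈u → All.tabulate λ {c} _ → cl b c b∈u)
    (All.all? (λ b → All.all? (λ c → (b <? c) →-dec ¬? (_⊆?_ _≟_ (c ∷ c ∷ []) v)) v) u)

#clear : Word → ℕ
#clear = ∑splits (λ u v → ⟦ Clear? u v ⟧)

distinct⇒clear : ∀ u v → Distinct v → Clear u v
distinct⇒clear u v d b c _ _ = d c

-- The repeated letters that matter exceed a letter of `u`, hence exceed `x`.
clear-erase : ∀ {x u v} t → Fresh x u → erase x t ≡ v → Clear u t ⇔ Clear u v
clear-erase {x} t fu refl = mk⇔
  (λ cl b c b∈u b<c s → cl b c b∈u b<c (⊆-trans s (erase-⊆ x t)))
  (λ cl b c b∈u b<c s → let x≢c = <⇒≢ (<-trans (All.lookup fu b∈u) b<c) in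
                        cl b c b∈u b<c (⊆-erase (x≢c ∷ x≢c ∷ []) s))

-- Once `x` belongs to the first part it forbids every repetition of a larger letter, and the other
-- letters there, being at least `x`, forbid nothing more.
clear-after : ∀ {x u v} t → x ∈ u → All (x ≤_) u → Fresh x v → erase x t ≡ v → Clear u t ⇔ Distinct v
clear-after {x} t x∈u x≤u fv refl = mk⇔
  (λ cl c s → cl x c x∈u (All.lookup fv (to∈ s)) (⊆-trans s (erase-⊆ x t)))
  (λ d b c b∈u b<c s → let x≢c = <⇒≢ (≤-<-trans (All.lookup x≤u b∈u) b<c) in
                       d c (⊆-erase (x≢c ∷ x≢c ∷ []) s))

module _ (x p q : ℕ) where
  open Insertion x p q

  -- Cuts inside `u` keep their status and the cut before the first `x` is a site. Each later cut is
  -- a site iff the letters above `x` behind it are distinct: a constant for the `p` cuts inside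
  -- `left`, always true for the `suc q` cuts behind `v`.
  #clear-ins : ∀ {u v} → Fresh x u → Fresh x v → Clear u v →
    #clear (ins u v) ≡
    ∑init (λ u₁ u₂ → ⟦ Clear? u₁ (u₂ ++ v) ⟧) u +
    (1 + (p * ⟦ Distinct? v ⟧ + (∑init (λ _ t → ⟦ Distinct? t ⟧) v + suc q)))
  #clear-ins {u} {v} fu fv cl = trans (∑splits-ins (λ u v → ⟦ Clear? u v ⟧) u v)
    (cong₂ _+_
      (∑init-cong u λ u₁ u₂ e →
        let fu₁ = All.++⁻ˡ u₁ (subst (Fresh x) (sym e) fu)
            fu₂ = All.++⁻ʳ u₁ (subst (Fresh x) (sym e) fu)
        in ⟦⟧-cong (Clear? _ _) (Clear? _ _) (clear-erase (ins u₂ v) fu₁ (erase-ins fu₂ fv)))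
    (cong₂ _+_
      (⟦⟧-yes (Clear? _ _) (from (clear-erase (ins [] v) fu (erase-ins [] fv)) cl))
    (cong₂ _+_
      (trans (∑init-cong left λ t₁ t₂ e →
                let bt₁ = All.++⁻ˡ t₁ (subst (Block x) (sym e) (block x p))
                    bt₂ = All.++⁻ʳ t₁ (subst (Block x) (sym e) (block x p))
                in after _ bt₁ fv (erase-block-right bt₂ fv))
             (trans (∑init-const ⟦ Distinct? v ⟧ left) (cong (_* ⟦ Distinct? v ⟧) (length-replicate p))))
    (trans (∑splits-++ (λ t₁ t₂ → ⟦ Clear? (u ++ x ∷ left ++ t₁) t₂ ⟧) v right)
    (cong₂ _+_
      (∑init-cong v λ v₁ v₂ e →
        let fv₁ = All.++⁻ˡ v₁ (subst (Fresh x) (sym e) fv)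
            fv₂ = All.++⁻ʳ v₁ (subst (Fresh x) (sym e) fv)
        in ⟦⟧-cong (Clear? _ _) (Distinct? _)
             (clear-after _ x∈ (x≤ (All.++⁺ x≤left (All.map <⇒≤ fv₁))) fv₂ (erase-right fv₂)))
      (trans (∑splits-all (λ t₁ t₂ → Clear? (u ++ x ∷ left ++ (v ++ t₁)) t₂) right λ t₁ t₂ e →
                let bt₁ = All.++⁻ˡ t₁ (subst (Block x) (sym e) (block x q))
                    bt₂ = All.++⁻ʳ t₁ (subst (Block x) (sym e) (block x q))
                in from (clear-after t₂ x∈ (x≤ (All.++⁺ x≤left (All.++⁺ (All.map <⇒≤ fv) (All.map ≤-reflexive bt₁))))
                                     [] (erase-block bt₂)) (λ _ ()))
             (cong suc (length-replicate q))))))))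
    where
    x∈ : ∀ {t} → x ∈ u ++ x ∷ t
    x∈ = ∈-++⁺ʳ u (here refl)
    x≤ : ∀ {t} → All (x ≤_) t → All (x ≤_) (u ++ x ∷ t)
    x≤ x≤t = All.++⁺ (All.map <⇒≤ fu) (≤-refl ∷ x≤t)
    x≤left : All (x ≤_) left
    x≤left = All.map ≤-reflexive (block x p)
    after : ∀ {t₁ v} t → Block x t₁ → Fresh x v → erase x t ≡ v →
            ⟦ Clear? (u ++ x ∷ t₁) t ⟧ ≡ ⟦ Distinct? v ⟧
    after t bt₁ fv e = ⟦⟧-cong (Clear? _ t) (Distinct? _) (clear-after t x∈ (x≤ (All.map ≤-reflexive bt₁)) fv e)

  #clear-ins-distinct : ∀ {u v} → Fresh x u → Fresh x v → Distinct v →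
                        #clear (ins u v) ≡ #clear (u ++ v) + suc (p + q)
  #clear-ins-distinct {u} {v} fu fv dv
    rewrite #clear-ins fu fv (distinct⇒clear u v dv) | ⟦⟧-yes (Distinct? v) dv | ∑init-distinct v dv
          | ∑splits-++ (λ u v → ⟦ Clear? u v ⟧) u v
          | ∑splits-all (λ v₁ v₂ → Clear? (u ++ v₁) v₂) v
              (λ v₁ v₂ e → distinct⇒clear (u ++ v₁) v₂ (Distinct-⊆ (suffix-⊆ v₁ e) dv)) =
      arith (∑init (λ u₁ u₂ → ⟦ Clear? u₁ (u₂ ++ v) ⟧) u) p q (length v)
    where
    arith : ∀ a p q l → a + (1 + (p * 1 + (l + suc q))) ≡ a + suc l + suc (p + q)
    arith = solve-∀

  -- The cuts inside `left` fail. The distinct suffixes of `u ++ v` are suffixes of `v`, so the cuts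
  -- inside `v` give `#distinct (u ++ v)` less the empty suffix.
  #clear-ins-¬distinct : ∀ {u v} → Fresh x u → Fresh x v → Clear u v → ¬ Distinct v →
    #clear (ins u v) ≡ q + suc (#distinct (u ++ v) + ∑init (λ u₁ u₂ → ⟦ Clear? u₁ (u₂ ++ v) ⟧) u)
  #clear-ins-¬distinct {u} {v} fu fv cl ¬dv
    rewrite #clear-ins fu fv cl | ⟦⟧-no (Distinct? v) ¬dv | #distinct-++ u v | ∑init-¬distinct u v ¬dv =
      arith (∑init (λ u₁ u₂ → ⟦ Clear? u₁ (u₂ ++ v) ⟧) u) p q (∑init (λ _ t → ⟦ Distinct? t ⟧) v)
    where
    arith : ∀ a p q b → a + (1 + (p * 0 + (b + suc q))) ≡ q + suc (suc b + a)
    arith = solve-∀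

rule-2133 : Rule p2133
rule-2133 = record
  { Site       = Clear
  ; Site?      = Clear?
  ; Site-[]    = λ _ _ ()
  ; omits-[]   = λ _ _ _ _ _ ()
  ; site⇒omits = site⇒omits
  ; omits⇒site = omits⇒site
  ; ∑-children = ∑-children
  }
  where
  site⇒omits : ∀ x p q {u v} → Fresh x u → Fresh x v → (u ++ v) Omits p2133 → Clear u v →
               Insertion.ins x p q u v Omits p2133
  site⇒omits x p q {u} {v} fu fv o cl a b c a<b b<c s with x ≟ a
  ... | yes refl = cl b c b∈u b<c (subst (c ∷ c ∷ [] ⊆_) (erase-tail fv)
                     (⊆-erase (x≢c ∷ x≢c ∷ []) (∷-⊆-first fu (∷ˡ⁻ s))))
    where
    open Insertion x p q
    x≢c = <⇒≢ (<-trans a<b b<c)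
    -- If `b` stood behind the first `x`, it would lie in `v`, so the `x` after it would lie in
    -- `right`, where no larger `c` follows.
    b∈u : b ∈ u
    b∈u with ∷-⊆-++ u s
    ... | inj₁ b∈u = b∈u
    ... | inj₂ s₁ with ∷-⊆-++ (x ∷ left) s₁
    ...   | inj₁ b∈left = contradiction (All.lookup (refl ∷ block x p) b∈left) (<⇒≢ a<b)
    ...   | inj₂ s₂ with ∷-⊆-++ v (∷ˡ⁻ s₂)
    ...     | inj₁ x∈v = contradiction x∈v (fresh⇒∉ fv)
    ...     | inj₂ s₃  = contradiction (All.lookup (block x q) (to∈ (∷ˡ⁻ s₃))) x≢c
  ... | no x≢a = o a b c a<b b<c (subst (b ∷ a ∷ c ∷ c ∷ [] ⊆_) (erase-ins fu fv)
                   (⊆-erase (<⇒≢ x<b ∷ x≢a ∷ x≢c ∷ x≢c ∷ []) s))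
    where
    open Insertion x p q
    x≤a = All.lookup (≤-erase (ins u v) (subst (Fresh x) (sym (erase-ins fu fv)) (All.++⁺ fu fv))) (to∈ (∷ˡ⁻ s))
    x<b = ≤-<-trans x≤a a<b
    x≢c = <⇒≢ (<-trans x<b b<c)
  omits⇒site : ∀ x p q {u v} → Fresh x u → Fresh x v → Insertion.ins x p q u v Omits p2133 → Clear u v
  omits⇒site x p q {u} {v} fu fv o b c b∈u b<c s =
    o x b c (All.lookup fu b∈u) b<c (++⁺ (from∈ b∈u) (refl ∷ ++⁺ˡ left (++⁺ʳ right s)))
    where open Insertion x p q
  ∑-children : ∀ x p q {w} → Fresh x w → ∀ φ →
    ∑splits (λ u v → ⟦ Clear? u v ⟧ * φ (#clear (Insertion.ins x p q u v)) (#distinct (Insertion.ins x p q u v))) w ≡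
    Transition.T x p q φ (#clear w) (#distinct w)
  ∑-children x p q {w} fw φ = trans
    (∑splits-cong w λ { u v refl → ⟦⟧*-cong (Clear? u v) λ cl → ifDistinct-intro v
      (λ d → cong₂ φ (#clear-ins-distinct x p q (All.++⁻ˡ u fw) (All.++⁻ʳ u fw) d)
                     (#distinct-ins-distinct x p q (All.++⁻ˡ u fw) (All.++⁻ʳ u fw) d))
      (λ ¬d → cong₂ φ (#clear-ins-¬distinct x p q (All.++⁻ˡ u fw) (All.++⁻ʳ u fw) cl ¬d)
                      (#distinct-ins-¬distinct x p q (All.++⁻ˡ u fw) (All.++⁻ʳ u fw) ¬d)) })
    (∑sites-before Clear? distinct⇒clear (λ j → φ (#clear w + suc (p + q)) (δ (#distinct w) j))
                   (λ k → φ (q + suc (#distinct w + k)) (δ′ (#distinct w))) 0 w)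
    where open Insertion x p q

-- The patterns 121 and 112

first-occurrence : ∀ {x w} → All (x ≤_) w → 0 < length (keep x w) →
                   ∃₂ λ u r → Fresh x u × All (x ≤_) r × w ≡ u ++ x ∷ r
first-occurrence {x} {[]} [] ()
first-occurrence {x} {y ∷ w} (x≤y ∷ x≤w) pos with x ≟ y
... | yes refl = [] , w , [] , x≤w , refl
... | no x≢y with first-occurrence x≤w (subst (λ z → 0 < length z) (filter-reject (x ≟_) x≢y) pos)
...   | u , r , fu , x≤r , refl = y ∷ u , r , ≤∧≢⇒< x≤y x≢y ∷ fu , x≤r , refl

-- p a and q a say how the a further copies of the least letter x are distributed between
-- the place right after the first copy and the end of the word.
record Shape (τ : Word) : Set where
  field
    p q : ℕ → ℕ
    p+q : ∀ a → p a + q a ≡ a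
    omits-[] : [] Omits τ
    ins-omits : ∀ a {x u v} → Fresh x u → Fresh x v → (u ++ v) Omits τ →
                Insertion.ins x (p a) (q a) u v Omits τ
    omits⇒ins : ∀ {a x w} → All (x ≤_) w → occurrences x w ≡ suc a → w Omits τ →
                ∃₂ λ u v → Fresh x u × Fresh x v × w ≡ Insertion.ins x (p a) (q a) u v

occurrences-ins : ∀ x p q {u v} → Fresh x u → Fresh x v →
                  occurrences x (Insertion.ins x p q u v) ≡ suc (p + q)
occurrences-ins x p q fu fv = trans (cong length (Insertion.keep-ins x p q fu fv))
  (cong suc (trans (length-++ (replicate p x)) (cong₂ _+_ (length-replicate p) (length-replicate q))))

least-letter : ∀ x p q {u v y} → Fresh x u → Fresh x v → y ∈ Insertion.ins x p q u v → x ≤ y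
least-letter x p q {u} {v} fu fv = All.lookup
  (≤-erase (ins u v) (subst (Fresh x) (sym (erase-ins fu fv)) (All.++⁺ fu fv)))
  where open Insertion x p q

shape-121 : Shape p121
shape-121 = record
  { p = id
  ; q = λ _ → 0
  ; p+q = +-identityʳ
  ; omits-[] = λ _ _ _ _ _ ()
  ; ins-omits = ins-omits
  ; omits⇒ins = omits⇒ins
  }
  where
  ins-omits : ∀ n {x u v} → Fresh x u → Fresh x v → (u ++ v) Omits p121 → Insertion.ins x n 0 u v Omits p121
  ins-omits n {x} {u} {v} fu fv o a b c a<b b<c s with x ≟ a
  -- Behind the first `x`, a larger `b` cannot be in the run of `x`, and no `x` follows that run.
  ... | yes refl with ∷-⊆-++ (replicate n x) (∷-⊆-first fu s)
  ...   | inj₁ b∈left = <⇒≢ a<b (All.lookup (block x n) b∈left)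
  ...   | inj₂ s′ = fresh⇒∉ (All.++⁺ fv []) (to∈ (∷ˡ⁻ s′))
  ins-omits n {x} {u} {v} fu fv o a b c a<b b<c s | no x≢a =
    o a b c a<b b<c (subst (a ∷ b ∷ a ∷ [] ⊆_) (Insertion.erase-ins x n 0 fu fv)
      (⊆-erase (x≢a ∷ <⇒≢ (≤-<-trans (least-letter x n 0 fu fv (to∈ s)) a<b) ∷ x≢a ∷ []) s))
  -- Once a letter above `x` is met, no `x` can follow. The trailing `[]` is `right` for `q = 0`.
  run : ∀ {x} r → All (x ≤_) r → (∀ y → x < y → ¬ (y ∷ x ∷ [] ⊆ r)) →
        ∃₂ λ n v → Fresh x v × r ≡ replicate n x ++ (v ++ [])
  run [] [] _ = 0 , [] , [] , refl
  run {x} (y ∷ r) (x≤y ∷ x≤r) no-yx with x ≟ y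
  ... | yes refl with run r x≤r (λ z x<z s → no-yx z x<z (y ∷ʳ s))
  ...   | n , v , fv , refl = suc n , v , fv , refl
  run {x} (y ∷ r) (x≤y ∷ x≤r) no-yx | no x≢y = 0 , y ∷ r , x<y ∷ All.tabulate fresh , sym (++-identityʳ (y ∷ r))
    where
    x<y = ≤∧≢⇒< x≤y x≢y
    fresh : ∀ {z} → z ∈ r → x < z
    fresh z∈r = ≤∧≢⇒< (All.lookup x≤r z∈r) λ { refl → no-yx y x<y (refl ∷ from∈ z∈r) }
  omits⇒ins : ∀ {a x w} → All (x ≤_) w → occurrences x w ≡ suc a → w Omits p121 →
              ∃₂ λ u v → Fresh x u × Fresh x v × w ≡ Insertion.ins x a 0 u v
  omits⇒ins {a} {x} x≤w occ o with first-occurrence x≤w (subst (0 <_) (sym occ) z<s)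
  ... | u , r , fu , x≤r , refl
    with run r x≤r (λ y x<y s → o x y (suc y) x<y (n<1+n y) (++⁺ˡ u (refl ∷ s)))
  ...   | n , v , fv , refl
    -- Counting the copies of `x` shows that the run has length `a`.
    with refl ← trans (sym (+-identityʳ n)) (suc-injective (trans (sym (occurrences-ins x n 0 fu fv)) occ)) =
      u , v , fu , fv , refl

shape-112 : Shape p112
shape-112 = record
  { p = λ _ → 0
  ; q = id
  ; p+q = λ _ → refl
  ; omits-[] = λ _ _ _ _ _ ()
  ; ins-omits = ins-omits
  ; omits⇒ins = omits⇒ins
  }
  where
  ins-omits : ∀ n {x u v} → Fresh x u → Fresh x v → (u ++ v) Omits p112 → Insertion.ins x 0 n u v Omits p112
  ins-omits n {x} {u} {v} fu fv o a b c a<b b<c s with x ≟ a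
  -- The second `x` must lie in the final block, where no larger letter follows.
  ... | yes refl with ∷-⊆-++ v (∷-⊆-first fu s)
  ...   | inj₁ x∈v = fresh⇒∉ fv x∈v
  ...   | inj₂ s′ = <⇒≢ a<b (All.lookup (block x n) (to∈ (∷ˡ⁻ s′)))
  ins-omits n {x} {u} {v} fu fv o a b c a<b b<c s | no x≢a =
    o a b c a<b b<c (subst (a ∷ a ∷ b ∷ [] ⊆_) (Insertion.erase-ins x 0 n fu fv)
      (⊆-erase (x≢a ∷ x≢a ∷ <⇒≢ (≤-<-trans (least-letter x 0 n fu fv (to∈ s)) a<b) ∷ []) s))
  -- Once an `x` is met, no larger letter can follow, so the rest is constant.
  run : ∀ {x} r → All (x ≤_) r → (∀ y → x < y → ¬ (x ∷ y ∷ [] ⊆ r)) →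
        ∃₂ λ n v → Fresh x v × r ≡ v ++ replicate n x
  run [] [] _ = 0 , [] , [] , refl
  run {x} (y ∷ r) (x≤y ∷ x≤r) no-xy with x ≟ y
  ... | yes refl = suc (length r) , [] , [] , cong (x ∷_) (constant r x≤r λ z z∈r x<z → no-xy z x<z (refl ∷ from∈ z∈r))
    where
    constant : ∀ r → All (x ≤_) r → (∀ z → z ∈ r → ¬ (x < z)) → r ≡ replicate (length r) x
    constant []      []           _ = refl
    constant (z ∷ r) (x≤z ∷ x≤r) ≯ = cong₂ _∷_ (≤-antisym (≮⇒≥ (≯ z (here refl))) x≤z)
                                                (constant r x≤r (λ z z∈r → ≯ z (there z∈r)))
  ... | no x≢y with run r x≤r (λ z x<z s → no-xy z x<z (y ∷ʳ s))
  ...   | n , v , fv , refl = n , y ∷ v , ≤∧≢⇒< x≤y x≢y ∷ fv , refl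
  omits⇒ins : ∀ {a x w} → All (x ≤_) w → occurrences x w ≡ suc a → w Omits p112 →
              ∃₂ λ u v → Fresh x u × Fresh x v × w ≡ Insertion.ins x 0 a u v
  omits⇒ins {a} {x} x≤w occ o with first-occurrence x≤w (subst (0 <_) (sym occ) z<s)
  ... | u , r , fu , x≤r , refl
    with run r x≤r (λ y x<y s → o x y (suc y) x<y (n<1+n y) (++⁺ˡ u (refl ∷ s)))
  ...   | n , v , fv , refl
    with refl ← suc-injective (trans (sym (occurrences-ins x 0 n fu fv)) occ) =
      u , v , fu , fv , refl

-- Generating the avoiding words

splits : Word → List (Word × Word)
splits []      = ([] , []) ∷ []
splits (c ∷ w) = ([] , c ∷ w) ∷ map (λ (u , v) → c ∷ u , v) (splits w)

∈-splits⁺ : ∀ u v → (u , v) ∈ splits (u ++ v)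
∈-splits⁺ []      []      = here refl
∈-splits⁺ []      (c ∷ v) = here refl
∈-splits⁺ (c ∷ u) v       = there (∈-map⁺ _ (∈-splits⁺ u v))

∈-splits⁻ : ∀ {u v} w → (u , v) ∈ splits w → u ++ v ≡ w
∈-splits⁻ []      (here refl) = refl
∈-splits⁻ (c ∷ w) (here refl) = refl
∈-splits⁻ (c ∷ w) (there uv∈) with ∈-map⁻ _ uv∈
... | (u , v) , uv∈′ , refl = cong (c ∷_) (∈-splits⁻ w uv∈′)

-- First components are compared, because `u`, the part before the first `x`, is what `first-unique`
-- recovers from an inserted word.
splits-unique : ∀ w → AllPairs (λ s t → proj₁ s ≢ proj₁ t) (splits w)
splits-unique []      = [] ∷ []
splits-unique (c ∷ w) = All.map⁺ (All.tabulate (λ _ ())) ∷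
  AllPairs.map⁺ (AllPairs.map (λ u≢u′ e → u≢u′ (∷-injectiveʳ e)) (splits-unique w))

sum-filter-splits : ∀ {Q : Word → Word → Set} (Q? : ∀ u v → Dec (Q u v)) (f : Word → Word → ℕ) w →
  sum (map (λ (u , v) → f u v) (filter (λ (u , v) → Q? u v) (splits w))) ≡ ∑splits (λ u v → ⟦ Q? u v ⟧ * f u v) w
sum-filter-splits Q? f w = trans (sum-filter (splits w)) (sum-splits (λ u v → ⟦ Q? u v ⟧ * f u v) w)
  where
  sum-splits : ∀ g w → sum (map (λ (u , v) → g u v) (splits w)) ≡ ∑splits g w
  sum-splits g []      = +-identityʳ _
  sum-splits g (c ∷ w) = cong (g [] (c ∷ w) +_)
    (trans (cong sum (sym (map-∘ (splits w)))) (sum-splits (λ u v → g (c ∷ u) v) w))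
  sum-filter : ∀ (xs : List (Word × Word)) → sum (map (λ (u , v) → f u v) (filter (λ (u , v) → Q? u v) xs)) ≡
                      sum (map (λ (u , v) → ⟦ Q? u v ⟧ * f u v) xs)
  sum-filter [] = refl
  sum-filter ((u , v) ∷ xs) with Q? u v
  ... | yes _ = cong₂ _+_ (sym (+-identityʳ _)) (sum-filter xs)
  ... | no _  = sum-filter xs

sum-concatMap : ∀ {A B : Set} (f : B → ℕ) (g : A → List B) xs →
                sum (map f (concatMap g xs)) ≡ sum (map (λ x → sum (map f (g x))) xs)
sum-concatMap f g []       = refl
sum-concatMap f g (x ∷ xs) = trans (cong sum (map-++ f (g x) (concatMap g xs)))
  (trans (sum-++ (map f (g x)) _) (cong (sum (map f (g x)) +_) (sum-concatMap f g xs)))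

sum-map-1 : ∀ {A : Set} (xs : List A) → sum (map (λ _ → 1) xs) ≡ length xs
sum-map-1 []       = refl
sum-map-1 (_ ∷ xs) = cong suc (sum-map-1 xs)

AllPairs-map-with : ∀ {A : Set} {P : A → Set} {R S : A → A → Set} →
  (∀ {x y} → P x → P y → R x y → S x y) → ∀ {xs} → All P xs → AllPairs R xs → AllPairs S xs
AllPairs-map-with f []         []         = []
AllPairs-map-with f (px ∷ pxs) (rs ∷ rss) =
  All.zipWith (λ (py , r) → f px py r) (pxs , rs) ∷ AllPairs-map-with f pxs rss

first-unique : ∀ {x} {u u′ r r′ : Word} → Fresh x u → Fresh x u′ → u ++ x ∷ r ≡ u′ ++ x ∷ r′ → u ≡ u′
first-unique []       []        e    = refl
first-unique []       (x<y ∷ _) refl = contradiction x<y (<-irrefl refl)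
first-unique (x<y ∷ _) []       refl = contradiction x<y (<-irrefl refl)
first-unique (_ ∷ fu) (_ ∷ fu′) e    = cong₂ _∷_ (∷-injectiveˡ e) (first-unique fu fu′ (∷-injectiveʳ e))

-- The list holds the multiplicities of x, suc x, …, each diminished by one.
Content : ℕ → List ℕ → Word → Set
Content x []      w = w ≡ []
Content x (a ∷ l) w = All (x ≤_) w × occurrences x w ≡ suc a × Content (suc x) l (erase x w)

content-≥ : ∀ {x} l {w} → Content x l w → All (x ≤_) w
content-≥ []      refl       = []
content-≥ (a ∷ l) (x≤w , _) = x≤w

-- Letters are inserted from the largest down, so `x` comes last; acting on functions of the state,
-- its operator meets `φ` first. The empty word has state (1 , 1).
total : (p q : ℕ → ℕ) → ℕ → List ℕ → (ℕ → ℕ → ℕ) → ℕ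
total p q x []      φ = φ 1 1
total p q x (a ∷ l) φ = total p q (suc x) l (Transition.T x (p a) (q a) φ)

module Generation {τ ρ : Word} (shape : Shape τ) (rule : Rule ρ) where
  open Shape shape
  open Rule rule hiding (omits-[])

  ins : ℕ → ℕ → Word × Word → Word
  ins x a (u , v) = Insertion.ins x (p a) (q a) u v

  sites : Word → List (Word × Word)
  sites w = filter (λ (u , v) → Site? u v) (splits w)

  children : ℕ → ℕ → Word → List Word
  children x a w = map (ins x a) (sites w)

  generate : ℕ → List ℕ → List Word
  generate x []      = [] ∷ []
  generate x (a ∷ l) = concatMap (children x a) (generate (suc x) l)

  Good : ℕ → List ℕ → Word → Set
  Good x l w = Content x l w × w Omits τ × w Omits ρ

  sites⁻ : ∀ {w s} → s ∈ sites w → (proj₁ s ++ proj₂ s ≡ w) × Site (proj₁ s) (proj₂ s)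
  sites⁻ {w} s∈ with ∈-filter⁻ (λ (u , v) → Site? u v) {xs = splits w} s∈
  ... | s∈splits , site = ∈-splits⁻ w s∈splits , site

  sites-fresh : ∀ {x w s} → Fresh x w → s ∈ sites w → Fresh x (proj₁ s) × Fresh x (proj₂ s)
  sites-fresh {x} {w} {u , v} fw s∈ with sites⁻ {w} s∈
  ... | refl , _ = All.++⁻ˡ u fw , All.++⁻ʳ u fw

  children⁻ : ∀ {x a w c} → Fresh x w → c ∈ children x a w →
    ∃₂ λ u v → Fresh x u × Fresh x v × Site u v × w ≡ u ++ v × c ≡ ins x a (u , v)
  children⁻ {w = w} fw c∈ with ∈-map⁻ _ c∈
  ... | (u , v) , s∈ , refl with sites⁻ {w} s∈
  ...   | refl , site = u , v , All.++⁻ˡ u fw , All.++⁻ʳ u fw , site , refl , refl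

  children-erase : ∀ {x a w c} → Fresh x w → c ∈ children x a w → erase x c ≡ w
  children-erase {x} {a} fw c∈ with children⁻ {a = a} fw c∈
  ... | u , v , fu , fv , _ , refl , refl = Insertion.erase-ins x (p a) (q a) fu fv

  generate⁻ : ∀ {x} l {w} → w ∈ generate x l → Good x l w
  generate⁻ []      (here refl) = refl , omits-[] , Rule.omits-[] rule
  generate⁻ {x} (a ∷ l) {c} c∈ with find (∈-concatMap⁻ (children x a) {xs = generate (suc x) l} c∈)
  ... | w , w∈ , c∈w with generate⁻ l w∈
  ...   | content , oτ , oρ with children⁻ {a = a} (content-≥ l content) c∈w
  ...     | u , v , fu , fv , site , refl , refl =
    ( All.tabulate (least-letter x (p a) (q a) fu fv)
    , trans (occurrences-ins x (p a) (q a) fu fv) (cong suc (p+q a))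
    , subst (Content (suc x) l) (sym (Insertion.erase-ins x (p a) (q a) fu fv)) content)
    , ins-omits a fu fv oτ
    , site⇒omits x (p a) (q a) fu fv oρ site

  -- Erasing the least letter preserves avoidance, and the word is a child of the result:
  -- `omits⇒ins` gives its form and `omits⇒site` the site.
  generate⁺ : ∀ {x} l {w} → Good x l w → w ∈ generate x l
  generate⁺ []      (refl , _) = here refl
  generate⁺ {x} (a ∷ l) {w} ((x≤w , occ , content) , oτ , oρ) with omits⇒ins x≤w occ oτ
  ... | u , v , fu , fv , refl = ∈-concatMap⁺ (children x a)
    (lose (generate⁺ l {u ++ v} (subst (Good (suc x) l) erased
             (content , Omits-⊆ (erase-⊆ x w) oτ , Omits-⊆ (erase-⊆ x w) oρ)))
          (∈-map⁺ (ins x a) (∈-filter⁺ (λ (u , v) → Site? u v) (∈-splits⁺ u v)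
                              (omits⇒site x (p a) (q a) fu fv oρ))))
    where erased = Insertion.erase-ins x (p a) (q a) fu fv

  generate-fresh : ∀ x l → All (Fresh x) (generate (suc x) l)
  generate-fresh x l = All.tabulate (λ w∈ → content-≥ l (proj₁ (generate⁻ l w∈)))

  children-unique : ∀ {x a w} → Fresh x w → Unique (children x a w)
  children-unique {x} {a} {w} fw = AllPairs.map⁺ (AllPairs-map-with
    (λ { (fu , _) (fu′ , _) u≢u′ e → u≢u′ (first-unique fu fu′ e) })
    (All.tabulate (sites-fresh fw))
    (AllPairs.filter⁺ (λ (u , v) → Site? u v) (splits-unique w)))

  generate-unique : ∀ x l → Unique (generate x l)
  generate-unique x []      = [] ∷ []
  generate-unique x (a ∷ l) = Unique.concat⁺
    (All.map⁺ (All.map (children-unique {a = a}) (generate-fresh x l)))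
    (AllPairs.map⁺ (AllPairs-map-with
      -- Erasing `x` recovers the parent, so different words share no child.
      (λ { fw fw′ w≢w′ (c∈ , c∈′) → w≢w′ (trans (sym (children-erase {a = a} fw c∈)) (children-erase {a = a} fw′ c∈′)) })
      (generate-fresh x l) (generate-unique (suc x) l)))

  -- Stated for every `φ`, so that the induction hypothesis applies to `T φ`.
  ∑-generate : ∀ x l φ → sum (map (λ w → φ (#sites w) (#distinct w)) (generate x l)) ≡ total p q x l φ
  ∑-generate x []      φ = trans (+-identityʳ _) (cong₂ φ (⟦⟧-yes (Site? [] []) Site-[]) Distinct-[])
  ∑-generate x (a ∷ l) φ = begin
    sum (map Φ (concatMap (children x a) (generate (suc x) l)))
      ≡⟨ sum-concatMap Φ (children x a) (generate (suc x) l) ⟩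
    sum (map (λ w → sum (map Φ (children x a w))) (generate (suc x) l))
      ≡⟨ cong sum (map-cong-local (All.map per-word (generate-fresh x l))) ⟩
    sum (map (λ w → T φ (#sites w) (#distinct w)) (generate (suc x) l))
      ≡⟨ ∑-generate (suc x) l (T φ) ⟩
    total p q (suc x) l (T φ) ∎
    where
    open ≡-Reasoning
    open Transition x (p a) (q a)
    Φ : Word → ℕ
    Φ w = φ (#sites w) (#distinct w)
    per-word : ∀ {w} → Fresh x w → sum (map Φ (children x a w)) ≡ T φ (#sites w) (#distinct w)
    per-word {w} fw = trans (cong sum (sym (map-∘ (sites w))))
      (trans (sum-filter-splits Site? (λ u v → Φ (ins x a (u , v))) w) (∑-children x (p a) (q a) fw φ))

  length-generate : ∀ x l → length (generate x l) ≡ total p q x l (λ _ _ → 1)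
  length-generate x l = trans (sym (sum-map-1 (generate x l))) (∑-generate x l (λ _ _ → 1))

-- Multipermutations

occurrences-erase : ∀ {x y} → x ≢ y → ∀ w → occurrences y (erase x w) ≡ occurrences y w
occurrences-erase x≢y [] = refl
occurrences-erase {x} {y} x≢y (z ∷ w) with x ≟ z
... | yes refl = trans (cong (occurrences y) (erase-head x w))
  (trans (occurrences-erase x≢y w) (cong length (sym (filter-reject (y ≟_) (x≢y ∘ sym)))))
... | no x≢z rewrite filter-accept (λ y → ¬? (x ≟ y)) {xs = w} x≢z with y ≟ z
...   | yes y≡z rewrite filter-accept (y ≟_) {xs = erase x w} y≡z | filter-accept (y ≟_) {xs = w} y≡z =
        cong suc (occurrences-erase x≢y w)
...   | no y≢z rewrite filter-reject (y ≟_) {xs = erase x w} y≢z | filter-reject (y ≟_) {xs = w} y≢z =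
        occurrences-erase x≢y w

InRange : ℕ → ℕ → Word → Set
InRange x n = All (λ y → x ≤ y × y < x + n)

range-erase : ∀ {x n} w → All (x ≤_) w → InRange x (suc n) w ⇔ InRange (suc x) n (erase x w)
range-erase {x} {n} w x≤w = mk⇔
  (λ r → All.tabulate λ {y} y∈ → strict r y (∈-filter⁻ (λ y → ¬? (x ≟ y)) {xs = w} y∈))
  (λ r → All.tabulate λ {y} y∈ → All.lookup x≤w y∈ , bound r y y∈)
  where
  strict : InRange x (suc n) w → ∀ y → y ∈ w × x ≢ y → x < y × y < suc x + n
  strict r y (y∈w , x≢y) with All.lookup r y∈w
  ... | x≤y , y<x+n = ≤∧≢⇒< x≤y x≢y , subst (y <_) (+-suc x n) y<x+n
  bound : InRange (suc x) n (erase x w) → ∀ y → y ∈ w → y < x + suc n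
  bound r y y∈ with x ≟ y
  ... | yes refl = m<m+n x z<s
  ... | no x≢y   = subst (y <_) (sym (+-suc x n)) (proj₂ (All.lookup r (∈-filter⁺ (λ y → ¬? (x ≟ y)) y∈ x≢y)))

-- By induction on `n`: erasing `x` changes no other count and raises the lower end of the range to
-- `suc x`.
content⇔ : ∀ n x (m : Fin n → ℕ) w → Content x (tabulate m) w ⇔
           ((∀ i → occurrences (x + toℕ i) w ≡ suc (m i)) × InRange x n w)
content⇔ zero x m w = mk⇔ (λ { refl → (λ ()) , [] }) (empty w ∘ proj₂)
  where
  empty : ∀ w → InRange x 0 w → w ≡ []
  empty []      []                  = refl
  empty (y ∷ w) ((x≤y , y<x+0) ∷ _) =
    contradiction (<-≤-trans y<x+0 (≤-trans (≤-reflexive (+-identityʳ x)) x≤y)) (<-irrefl refl)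
content⇔ (suc n) x m w = mk⇔
  (λ { (x≤w , occ , content) → let occs , range = to ih content in
       (λ { zero    → trans (cong (λ y → occurrences y w) (+-identityʳ x)) occ
          ; (suc i) → trans (sym (shift i)) (occs i) })
       , from (range-erase w x≤w) range })
  (λ { (occs , range) → let x≤w = All.map proj₁ range in
       x≤w , trans (cong (λ y → occurrences y w) (sym (+-identityʳ x))) (occs zero)
       , from ih ((λ i → trans (shift i) (occs (suc i))) , to (range-erase w x≤w) range) })
  where
  ih = content⇔ n (suc x) (m ∘ suc) (erase x w)
  shift : ∀ i → occurrences (suc x + toℕ i) (erase x w) ≡ occurrences (x + suc (toℕ i)) w
  shift i = trans (occurrences-erase (<⇒≢ (m≤m+n (suc x) (toℕ i))) w)
                  (cong (λ y → occurrences y w) (sym (+-suc x (toℕ i))))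

contents : Multiset → List ℕ
contents S = tabulate (pred ∘ Multiset.mult S)

isMultiperm⇔content : ∀ S w → IsMultiperm S w ⇔ Content 1 (contents S) w
isMultiperm⇔content S w = mk⇔
  (λ { (occs , range) → from c ((λ i → trans (occs i) (sym (positive i))) , All.map (λ (l , u) → l , s≤s u) range) })
  (λ content → let occs , range = to c content in
    (λ i → trans (occs i) (positive i)) , All.map (λ (l , u) → l , s≤s⁻¹ u) range)
  where
  open Multiset S
  c = content⇔ k 1 (pred ∘ mult) w
  -- As `mult≥1` holds, taking `pred` loses nothing.
  positive : ∀ i → suc (pred (mult i)) ≡ mult i
  positive i = suc-pred (mult i) {{>-nonZero (mult≥1 i)}}

module _ {τ ρ : Word} (shape : Shape τ) (rule : Rule ρ)
         (avoids⇔τ : ∀ {π} → π Avoids τ ⇔ π Omits τ) (avoids⇔ρ : ∀ {π} → π Avoids ρ ⇔ π Omits ρ) where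
  open Generation shape rule
  open Shape shape using (p; q)

  -- Two duplicate-free lists with the same members have the same length. The right-hand side
  -- depends on the shape but not on `ρ`, so 1233 and 2133 give the same number.
  av≡total : ∀ S → av S (τ ∷ ρ ∷ []) ≡ total p q 1 (contents S) (λ _ _ → 1)
  av≡total S = trans
    (↭-length (∼bag⇒↭ (unique∧set⇒bag (Unique.filter⁺ avoids? (multiperms-unique S)) (generate-unique 1 (contents S))
      (mk⇔ to-generate from-generate))))
    (length-generate 1 (contents S))
    where
    avoids? = avoidsAll? (τ ∷ ρ ∷ [])
    to-generate : ∀ {w} → w ∈ filter avoids? (multiperms S) → w ∈ generate 1 (contents S)
    to-generate {w} w∈ with ∈-filter⁻ avoids? {xs = multiperms S} w∈
    ... | w∈S , aτ ∷ aρ ∷ [] = generate⁺ (contents S)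
      (to (isMultiperm⇔content S w) (to (∈-multiperms S w) w∈S) , to avoids⇔τ aτ , to avoids⇔ρ aρ)
    from-generate : ∀ {w} → w ∈ generate 1 (contents S) → w ∈ filter avoids? (multiperms S)
    from-generate {w} w∈ with generate⁻ (contents S) w∈
    ... | content , oτ , oρ = ∈-filter⁺ avoids? (from (∈-multiperms S w) (from (isMultiperm⇔content S w) content))
                                                (from avoids⇔τ oτ ∷ from avoids⇔ρ oρ ∷ [])

avoids⇔121 : ∀ {π} → π Avoids p121 ⇔ π Omits p121
avoids⇔121 = mk⇔ (avoids⇒omits p121 (from-yes (letters? p121))) omits⇒avoids-121

avoids⇔112 : ∀ {π} → π Avoids p112 ⇔ π Omits p112
avoids⇔112 = mk⇔ (avoids⇒omits p112 (from-yes (letters? p112))) omits⇒avoids-112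

avoids⇔1233 : ∀ {π} → π Avoids p1233 ⇔ π Omits p1233
avoids⇔1233 = mk⇔ (avoids⇒omits p1233 (from-yes (letters? p1233))) omits⇒avoids-1233

avoids⇔2133 : ∀ {π} → π Avoids p2133 ⇔ π Omits p2133
avoids⇔2133 = mk⇔ (avoids⇒omits p2133 (from-yes (letters? p2133))) omits⇒avoids-2133

theorem2p22 : (((1 ∷ 2 ∷ 1 ∷ []) ∷ (1 ∷ 2 ∷ 3 ∷ 3 ∷ []) ∷ [])
    ∼ ((1 ∷ 2 ∷ 1 ∷ []) ∷ (2 ∷ 1 ∷ 3 ∷ 3 ∷ []) ∷ []))
    × (((1 ∷ 1 ∷ 2 ∷ []) ∷ (1 ∷ 2 ∷ 3 ∷ 3 ∷ []) ∷ [])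
    ∼ ((1 ∷ 1 ∷ 2 ∷ []) ∷ (2 ∷ 1 ∷ 3 ∷ 3 ∷ []) ∷ []))
theorem2p22 =
  (λ S → trans (av≡total shape-121 rule-1233 avoids⇔121 avoids⇔1233 S)
               (sym (av≡total shape-121 rule-2133 avoids⇔121 avoids⇔2133 S))) ,
  (λ S → trans (av≡total shape-112 rule-1233 avoids⇔112 avoids⇔1233 S)
               (sym (av≡total shape-112 rule-2133 avoids⇔112 avoids⇔2133 S)))
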